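{- Let $r$ and $s$ be coprime positive integers with $1\le s<r/2$, and let $k\ge 1$ be an integer. Then there exists a constant $N(r,s,k)$, depending only on $r,s,k$, such that for every integer $n\ge N(r,s,k)$ the coefficient of $q^n$ in the power series expansion of $$(-1)^{k}\,\frac{\sum_{j=k}^{\infty}(-1)^j q^{r j(j+1)/2}\left(q^{ -sj}-q^{(j+1)s}\right)}{\left(q^s,q^{r-s};q^r\right)_{\infty}}$$ is nonnegative.
   Context: Notation: for $|q|<1$, $(a;q)_\infty=\prod_{n\ge 0}(1-aq^n)$ and $(a_1,\dots,a_m;q)_\infty=(a_1;q)_\infty\cdots(a_m;q)_\infty$. So $(q^s,q^{r-s};q^r)_\infty=\prod_{n\ge 0}(1-q^{s+rn})(1-q^{r-s+rn})$. -}

module Defs where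

open import Data.Nat.Base as ℕ using (ℕ; zero; suc; _≤_; _<_; _∸_; z≤n; s≤s)
import Data.Nat.DivMod as ℕ
import Data.Nat.Properties as ℕ
open import Data.Nat.Solver using (module +-*-Solver)
open import Data.Integer.Base as ℤ using (ℤ; 0ℤ; 1ℤ; -1ℤ; _+_; _-_; _*_; _^_)
import Data.Integer.Properties as ℤ
open import Data.Integer.Solver as ℤS using ()
open import Data.Bool.Base using (if_then_else_)
open import Data.Fin.Base using (toℕ)
open import Data.Product.Base using (∃; _,_)
open import Function.Base using (_∘_)
open import Relation.Nullary.Decidable.Core using (does)
open import Relation.Nullary.Decidable using (dec-false)
open import Relation.Binary.PropositionalEquality
open import Algebra.Properties.CommutativeMonoid.Sum ℤ.+-0-commutativeMonoid
  using (sum⁺-syntax; sum-cong-≗)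

-- The series f is Σₙ f(n) qⁿ.
Series : Set
Series = ℕ → ℤ

infixl 6 _⊕_ _⊖_
infixl 7 _⊛_ _⊘_ _·_

0ₛ : Series
0ₛ _ = 0ℤ

q^_ : ℕ → Series
(q^ e) n = if does (e ℕ.≟ n) then 1ℤ else 0ℤ

1ₛ : Series
1ₛ = q^ 0

_⊕_ _⊖_ _⊛_ : Series → Series → Series
(f ⊕ g) n = f n + g n
(f ⊖ g) n = f n - g n
(f ⊛ g) n = ∑[ i ≤ n ] (f (toℕ i) * g (n ∸ toℕ i))

remainder : Series → Series → Series
remainder f g m = f (suc m) - f 0 * g (suc m)

-- Long division by a series with constant term 1; see ⊘-⊛ and ⊘-unique
-- below.  Meaningless for other divisors.
_⊘_ : Series → Series → Series
(f ⊘ g) zero    = f 0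
(f ⊘ g) (suc n) = (remainder f g ⊘ g) n

_·_ : ℤ → Series → Series
(c · f) n = c * f n

-- Convergence in the q-adic topology: every coefficient is eventually
-- constant.
_⟶_ : (ℕ → Series) → Series → Set
u ⟶ f = ∀ n → ∃ λ M → ∀ i → M ≤ i → u i n ≡ f n

-- This is the limit of u as soon as the coefficient of qⁿ is constant from
-- the index n + 1 on, which holds for the sums and products used here; see
-- ⟶-theta and ⟶-qPochhammer.
limit : (ℕ → Series) → Series
limit u n = u (suc n) n

-- t k ⊕ t (k + 1) ⊕ … (i terms)
partialSum : (ℕ → Series) → ℕ → ℕ → Series
partialSum t k zero    = 0ₛ
partialSum t k (suc i) = partialSum t k i ⊕ t (k ℕ.+ i)

-- f 0 ⊛ f 1 ⊛ … (i factors)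
partialProduct : (ℕ → Series) → ℕ → Series
partialProduct f zero    = 1ₛ
partialProduct f (suc i) = partialProduct f i ⊛ f i

sumFrom : ℕ → (ℕ → Series) → Series
sumFrom k t = limit (partialSum t k)

infiniteProduct : (ℕ → Series) → Series
infiniteProduct f = limit (partialProduct f)

qFactor : ℕ → ℕ → ℕ → Series
qFactor a b n = 1ₛ ⊖ q^ (a ℕ.+ b ℕ.* n)

-- (q^a ; q^b)_∞
qPochhammer : ℕ → ℕ → Series
qPochhammer a b = infiniteProduct (qFactor a b)

-- (q^s , q^(r-s) ; q^r)_∞
denominator : ℕ → ℕ → Series
denominator r s = qPochhammer s r ⊛ qPochhammer (r ∸ s) r

-- r j (j + 1) / 2; the division is exact.
exponent : ℕ → ℕ → ℕ
exponent r j = (r ℕ.* (j ℕ.* (j ℕ.+ 1))) ℕ./ 2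

-- When 2 s < r the subtraction is not truncated; see sj≤exponent.
thetaTerm : ℕ → ℕ → ℕ → Series
thetaTerm r s j =
  (-1ℤ ^ j) · (q^ (exponent r j ∸ s ℕ.* j) ⊖ q^ (exponent r j ℕ.+ (j ℕ.+ 1) ℕ.* s))

numerator : ℕ → ℕ → ℕ → Series
numerator r s k = sumFrom k (thetaTerm r s)

truncatedSeries : ℕ → ℕ → ℕ → Series
truncatedSeries r s k = (-1ℤ ^ k) · (numerator r s k ⊘ denominator r s)

⊘-⊛ : ∀ f g → g 0 ≡ 1ℤ → ∀ n → ((f ⊘ g) ⊛ g) n ≡ f n
⊘-⊛ f g g₀ zero rewrite g₀ = trans (ℤ.+-identityʳ _) (ℤ.*-identityʳ (f 0))
⊘-⊛ f g g₀ (suc n) = begin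
  f 0 * g (suc n) + ((remainder f g ⊘ g) ⊛ g) n
    ≡⟨ cong (f 0 * g (suc n) +_) (⊘-⊛ (remainder f g) g g₀ n) ⟩
  f 0 * g (suc n) + (f (suc n) - f 0 * g (suc n))
    ≡⟨ solve 2 (λ x y → x :+ (y :- x) := y) refl (f 0 * g (suc n)) (f (suc n)) ⟩
  f (suc n) ∎
  where
  open ≡-Reasoning
  open ℤS.+-*-Solver

⊘-unique : ∀ f g h → g 0 ≡ 1ℤ → (∀ n → (h ⊛ g) n ≡ f n) → ∀ n → h n ≡ (f ⊘ g) n
⊘-unique f g h g₀ eq zero = begin
  h 0              ≡⟨ ℤ.*-identityʳ (h 0) ⟨
  h 0 * 1ℤ         ≡⟨ cong (h 0 *_) g₀ ⟨
  h 0 * g 0        ≡⟨ ℤ.+-identityʳ _ ⟨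
  h 0 * g 0 + 0ℤ   ≡⟨ eq 0 ⟩
  f 0              ∎
  where open ≡-Reasoning
⊘-unique f g h g₀ eq (suc n) = ⊘-unique (remainder f g) g (h ∘ suc) g₀ tail-eq n
  where
  open ≡-Reasoning
  open ℤS.+-*-Solver
  tail-eq : ∀ m → ((h ∘ suc) ⊛ g) m ≡ remainder f g m
  tail-eq m = begin
    ((h ∘ suc) ⊛ g) m
      ≡⟨ solve 2 (λ x y → y := (x :+ y) :- x) refl (h 0 * g (suc m)) _ ⟩
    (h ⊛ g) (suc m) - h 0 * g (suc m)
      ≡⟨ cong₂ (λ x y → x - y * g (suc m)) (eq (suc m)) (⊘-unique f g h g₀ eq 0) ⟩
    remainder f g m ∎

q^-≡0 : ∀ e n → n < e → (q^ e) n ≡ 0ℤ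
q^-≡0 e n n<e rewrite dec-false (e ℕ.≟ n) (ℕ.>⇒≢ n<e) = refl

stable⇒⟶limit : ∀ u → (∀ i n → n < i → u (suc i) n ≡ u i n) → u ⟶ limit u
stable⇒⟶limit u stable n = suc n , λ i n<i →
  subst (λ i → u i n ≡ u (suc n) n) (ℕ.m∸n+n≡m n<i) (go (i ∸ suc n))
  where
  go : ∀ d → u (d ℕ.+ suc n) n ≡ u (suc n) n
  go zero    = refl
  go (suc d) = trans (stable (d ℕ.+ suc n) n (ℕ.m≤n+m (suc n) d)) (go d)

⟶-sumFrom : ∀ t → (∀ j n → n < j → t j n ≡ 0ℤ) → ∀ k → partialSum t k ⟶ sumFrom k t
⟶-sumFrom t small k = stable⇒⟶limit (partialSum t k) λ i n n<i →
  trans (cong (partialSum t k i n +_) (small (k ℕ.+ i) n (ℕ.≤-trans n<i (ℕ.m≤n+m i k))))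
        (ℤ.+-identityʳ _)

⊛-identityʳ : ∀ f n → (f ⊛ 1ₛ) n ≡ f n
⊛-identityʳ f zero    = trans (ℤ.+-identityʳ _) (ℤ.*-identityʳ (f 0))
⊛-identityʳ f (suc n) = trans (cong₂ _+_ (ℤ.*-zeroʳ (f 0)) (⊛-identityʳ (f ∘ suc) n))
                              (ℤ.+-identityˡ _)

⟶-infiniteProduct : ∀ f → (∀ j n → n < j → f j n ≡ 1ₛ n) →
                    partialProduct f ⟶ infiniteProduct f
⟶-infiniteProduct f small = stable⇒⟶limit (partialProduct f) λ i n n<i →
  trans (sum-cong-≗ {suc n} λ l → cong (partialProduct f i (toℕ l) *_)
          (small i (n ∸ toℕ l) (ℕ.≤-<-trans (ℕ.m∸n≤m n (toℕ l)) n<i)))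
        (⊛-identityʳ (partialProduct f i) n)

⟶-qPochhammer : ∀ a b → 1 ≤ a → 1 ≤ b →
                partialProduct (qFactor a b) ⟶ qPochhammer a b
⟶-qPochhammer a b@(suc _) 1≤a _ = ⟶-infiniteProduct (qFactor a b) λ j n n<j →
  trans (cong (λ x → 1ₛ n - x)
          (q^-≡0 _ n (ℕ.<-≤-trans n<j
            (ℕ.≤-trans (ℕ.m≤n*m j b) (ℕ.m≤n+m (b ℕ.* j) a)))))
        (ℤ.+-identityʳ (1ₛ n))

j+sj≤exponent : ∀ r s j → 2 ℕ.* s < r → j ℕ.+ s ℕ.* j ≤ exponent r j
j+sj≤exponent r s zero 2s<r rewrite ℕ.*-zeroʳ s = z≤n
j+sj≤exponent r s j@(suc i) 2s<r = begin
  j ℕ.+ s ℕ.* j                                  ≡⟨ ℕ.m*n/n≡m (j ℕ.+ s ℕ.* j) 2 ⟨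
  (j ℕ.+ s ℕ.* j) ℕ.* 2 ℕ./ 2                    ≤⟨ ℕ./-monoˡ-≤ 2 double ⟩
  exponent r j                                   ∎
  where
  open ℕ.≤-Reasoning
  open +-*-Solver
  double : (j ℕ.+ s ℕ.* j) ℕ.* 2 ≤ r ℕ.* (j ℕ.* (j ℕ.+ 1))
  double = begin
    (j ℕ.+ s ℕ.* j) ℕ.* 2
      ≤⟨ ℕ.m≤m+n _ (2 ℕ.* s ℕ.* j) ⟩
    (j ℕ.+ s ℕ.* j) ℕ.* 2 ℕ.+ 2 ℕ.* s ℕ.* j
      ≡⟨ solve 2 (λ s j → (j :+ s :* j) :* con 2 :+ con 2 :* s :* j
                       := (con 1 :+ con 2 :* s) :* (j :* con 2)) refl s j ⟩
    suc (2 ℕ.* s) ℕ.* (j ℕ.* 2)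
      ≤⟨ ℕ.*-mono-≤ 2s<r (ℕ.*-monoʳ-≤ j (s≤s (ℕ.m≤n+m 1 i))) ⟩
    r ℕ.* (j ℕ.* (j ℕ.+ 1)) ∎

sj≤exponent : ∀ r s j → 2 ℕ.* s < r → s ℕ.* j ≤ exponent r j
sj≤exponent r s j 2s<r = ℕ.≤-trans (ℕ.m≤n+m (s ℕ.* j) j) (j+sj≤exponent r s j 2s<r)

⟶-theta : ∀ r s k → 2 ℕ.* s < r → partialSum (thetaTerm r s) k ⟶ numerator r s k
⟶-theta r s k 2s<r = ⟶-sumFrom (thetaTerm r s) small k
  where
  small : ∀ j n → n < j → thetaTerm r s j n ≡ 0ℤ
  small j n n<j = trans
    (cong ((-1ℤ ^ j) *_) (cong₂ _-_
      (q^-≡0 _ n (ℕ.<-≤-trans n<j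
        (ℕ.m+n≤o⇒m≤o∸n j (j+sj≤exponent r s j 2s<r))))
      (q^-≡0 _ n (ℕ.<-≤-trans n<j (ℕ.≤-trans
        (ℕ.≤-trans (ℕ.m≤m+n j (s ℕ.* j)) (j+sj≤exponent r s j 2s<r))
        (ℕ.m≤m+n (exponent r j) _))))))
    (ℤ.*-zeroʳ (-1ℤ ^ j))

qPochhammer-0 : ∀ a b → 1 ≤ a → qPochhammer a b 0 ≡ 1ℤ
qPochhammer-0 (suc a) b _ = refl

denominator-0 : ∀ r s → 1 ≤ s → 2 ℕ.* s < r → denominator r s 0 ≡ 1ℤ
denominator-0 r s 1≤s 2s<r =
  cong₂ (λ x y → x * y + 0ℤ) (qPochhammer-0 s r 1≤s)
    (qPochhammer-0 (r ∸ s) r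
      (ℕ.m<n⇒0<n∸m (ℕ.≤-<-trans (ℕ.m≤n*m s 2) 2s<r)))

{-# OPTIONS --safe #-}
module Submission where

-- By the Jacobi triple product the sum over all j ≥ 0 divided by D = (q^s, q^(r-s); q^r)_∞ is
-- E = (q^r; q^r)_∞, so that (-1)^k times the tail divided by D equals (-1)^k E plus the head
-- Σ_{j<k} (-1)^(k-1-j) q^(r j (j+1)/2 - s j) (1 - q^((2j+1)s)) / D.  The coefficients of E grow at
-- most linearly (Euler's pentagonal number theorem, again a triple product).  The factor 1 - q^s
-- of D cancels and leaves a polynomial G with G(1) = k.  Now split off three further factors of D
-- with exponents a = r - s, a + r, a + 2r and write 1 / D = v P / (1 - q^s), where
-- v = 1 / ((1 - q^a)(1 - q^(a+r))(1 - q^(a+2r))).  Since a and a + r are coprime, (1 - q) v has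
-- coefficients O(n), so that G v agrees with k v, and v with 1 / (a (a+r) (a+2r) (1 - q)^3), up to
-- O(n): the coefficients of G v are at least a positive multiple of n^2 up to O(n).
-- Finally P grows so slowly that this suffices: its logarithmic derivative gives
-- n P(n) ≤ 2 Σ_m m^2 P(n - m), whence C Σ_m (m + 1) P(n - m) ≤ Σ_m m^2 P(n - m) for n large.

-- The lower bound for the coefficient of `q^m` in `G v` may be negative for the first few `m`, and
-- in the convolution these meet the top coefficients `P(n - m)`. If `P` grew geometrically they
-- could outweigh all the rest; hence the growth bound for `P`. The logarithmic derivative of a
-- product of geometric series yields one without asymptotics: at `q^m` at most `m` factors
-- contribute, each at most `m`, which gives `m^2` for each of the two products that make up `P`.
-- The same `m^2` explains the three factors `a`, `a + r`, `a + 2r`: a pole of order 3 at 1 gives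
-- `G v` a main term of just this size, so that the crude `m^2` suffices. Coprimality enters through
-- `gcd(a, a + r) = gcd(r, s) = 1`: roots of unity other than 1 are at most simple poles of
-- `1 / ((1 - q^a)(1 - q^(a+r)))`. All estimates stay in the integers, the denominators being
-- cleared by the factor `2 a (a+r) (a+2r)`.

open import Defs
open import Data.Nat.Base using (ℕ; zero; suc; _+_; _*_; _∸_; _≤_; _<_; z≤n; s≤s; >-nonZero)
import Data.Nat.Properties as ℕ
import Data.Nat.DivMod as ℕ
open import Data.Nat.Coprimality using (Coprime; coprime-Bézout)
open import Data.Nat.Divisibility using (_∣_; ∣m+n∣m⇒∣n)
open import Data.Nat.GCD using (module Bézout)
open import Data.Nat.Solver using () renaming (module +-*-Solver to ℕ-Solver)
open import Data.Integer.Base as ℤ using (ℤ; 0ℤ; 1ℤ; -1ℤ; ∣_∣)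
import Data.Integer.Properties as ℤ
open import Data.Integer.Solver using (module +-*-Solver)
open import Data.Maybe.Base using (Maybe; just; nothing)
open import Data.Product.Base using (∃; ∃-syntax; _×_; _,_; proj₁; proj₂)
open import Data.Sum.Base using (_⊎_; inj₁; inj₂)
open import Function.Base using (_∘_)
open import Level using (0ℓ)
open import Relation.Nullary using (yes; no)
open import Relation.Nullary.Decidable using (dec-false)
open import Relation.Binary.PropositionalEquality hiding ([_])
import Relation.Binary.Reasoning.Setoid as SetoidReasoning
open import Algebra.Bundles using (CommutativeRing)
open import Algebra.Solver.Ring.AlmostCommutativeRing
  using (fromCommutativeRing; _-Raw-AlmostCommutative⟶_)
import Algebra.Solver.Ring

-- The ring of power series

infix 4 _≈_

-- A record instead of a bare pointwise equality, so that unification sees `f` and `g` themselves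
-- and not their reduced coefficients.
record _≈_ (f g : Series) : Set where
  constructor pointwise
  field at : ∀ n → f n ≡ g n

open _≈_

⊝_ : Series → Series
(⊝ f) n = ℤ.- f n

-- 0 and 1 are separate cases so that `con 0ℤ` and `con 1ℤ` in the ring solver denote `0ₛ` and `1ₛ`
-- definitionally.
const : ℤ → Series
const (ℤ.+ 0) = 0ₛ
const (ℤ.+ 1) = 1ₛ
const c     = c · 1ₛ

≈-refl : ∀ {f} → f ≈ f
≈-refl .at n = refl

≈-sym : ∀ {f g} → f ≈ g → g ≈ f
≈-sym p .at n = sym (p .at n)

≈-trans : ∀ {f g h} → f ≈ g → g ≈ h → f ≈ h
≈-trans p q .at n = trans (p .at n) (q .at n)

⊛-congₙ : ∀ {f f′ g g′} n → (∀ i → i ≤ n → f i ≡ f′ i) → (∀ i → i ≤ n → g i ≡ g′ i) →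
          (f ⊛ g) n ≡ (f′ ⊛ g′) n
⊛-congₙ zero    p q = cong₂ (λ x y → x ℤ.* y ℤ.+ 0ℤ) (p 0 z≤n) (q 0 z≤n)
⊛-congₙ (suc n) p q = cong₂ ℤ._+_
  (cong₂ ℤ._*_ (p 0 z≤n) (q (suc n) ℕ.≤-refl))
  (⊛-congₙ n (λ i i≤n → p (suc i) (s≤s i≤n)) (λ i i≤n → q i (ℕ.m≤n⇒m≤1+n i≤n)))

⊛-cong : ∀ {f f′ g g′} → f ≈ f′ → g ≈ g′ → f ⊛ g ≈ f′ ⊛ g′
⊛-cong p q .at n = ⊛-congₙ n (λ i _ → p .at i) (λ i _ → q .at i)

⊛-congˡ : ∀ f {g g′} → g ≈ g′ → f ⊛ g ≈ f ⊛ g′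
⊛-congˡ f p = ⊛-cong (≈-refl {f}) p

⊛-congʳ : ∀ g {f f′} → f ≈ f′ → f ⊛ g ≈ f′ ⊛ g
⊛-congʳ g p = ⊛-cong p (≈-refl {g})

⊛-distribʳ : ∀ f g h → (f ⊕ g) ⊛ h ≈ (f ⊛ h) ⊕ (g ⊛ h)
⊛-distribʳ f g h .at zero =
  solve 3 (λ x y z → (x :+ y) :* z :+ con 0ℤ := (x :* z :+ con 0ℤ) :+ (y :* z :+ con 0ℤ))
    refl (f 0) (g 0) (h 0)
  where open +-*-Solver
⊛-distribʳ f g h .at (suc n) = trans
  (cong (ℤ._+_ ((f 0 ℤ.+ g 0) ℤ.* h (suc n))) (⊛-distribʳ (f ∘ suc) (g ∘ suc) h .at n))
  (solve 5 (λ x y z u v → (x :+ y) :* z :+ (u :+ v) := (x :* z :+ u) :+ (y :* z :+ v))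
    refl (f 0) (g 0) (h (suc n)) (((f ∘ suc) ⊛ h) n) (((g ∘ suc) ⊛ h) n))
  where open +-*-Solver

·-⊛ : ∀ c f g → (c · f) ⊛ g ≈ c · (f ⊛ g)
·-⊛ c f g .at zero = solve 3 (λ c x y → c :* x :* y :+ con 0ℤ := c :* (x :* y :+ con 0ℤ))
    refl c (f 0) (g 0)
  where open +-*-Solver
·-⊛ c f g .at (suc n) = trans
  (cong (ℤ._+_ (c ℤ.* f 0 ℤ.* g (suc n))) (·-⊛ c (f ∘ suc) g .at n))
  (solve 4 (λ c x y z → c :* x :* y :+ c :* z := c :* (x :* y :+ z))
    refl c (f 0) (g (suc n)) (((f ∘ suc) ⊛ g) n))
  where open +-*-Solver

-- By definition a convolution unfolds at its first summand; commutativity also needs it unfolded at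
-- the last.
⊛-unfoldʳ : ∀ f g n → (f ⊛ g) (suc n) ≡ (f ⊛ (g ∘ suc)) n ℤ.+ f (suc n) ℤ.* g 0
⊛-unfoldʳ f g zero = solve 4 (λ x y z w → x :* y :+ (z :* w :+ con 0ℤ) := (x :* y :+ con 0ℤ) :+ z :* w)
    refl (f 0) (g 1) (f 1) (g 0)
  where open +-*-Solver
⊛-unfoldʳ f g (suc n) = trans (cong (ℤ._+_ (f 0 ℤ.* g (suc (suc n)))) (⊛-unfoldʳ (f ∘ suc) g n))
  (sym (ℤ.+-assoc (f 0 ℤ.* g (suc (suc n))) _ _))

⊛-comm : ∀ f g → f ⊛ g ≈ g ⊛ f
⊛-comm f g .at zero = cong (ℤ._+ 0ℤ) (ℤ.*-comm (f 0) (g 0))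
⊛-comm f g .at (suc n) = begin
  f 0 ℤ.* g (suc n) ℤ.+ ((f ∘ suc) ⊛ g) n
    ≡⟨ cong (ℤ._+_ (f 0 ℤ.* g (suc n))) (⊛-comm (f ∘ suc) g .at n) ⟩
  f 0 ℤ.* g (suc n) ℤ.+ (g ⊛ (f ∘ suc)) n
    ≡⟨ solve 3 (λ x y z → x :* y :+ z := z :+ y :* x) refl (f 0) (g (suc n)) _ ⟩
  (g ⊛ (f ∘ suc)) n ℤ.+ g (suc n) ℤ.* f 0  ≡⟨ ⊛-unfoldʳ g f n ⟨
  (g ⊛ f) (suc n)                          ∎
  where
  open +-*-Solver
  open ≡-Reasoning

⊛-assoc : ∀ f g h → (f ⊛ g) ⊛ h ≈ f ⊛ (g ⊛ h)
⊛-assoc f g h .at zero =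
  solve 3 (λ x y z → (x :* y :+ con 0ℤ) :* z :+ con 0ℤ := x :* (y :* z :+ con 0ℤ) :+ con 0ℤ)
    refl (f 0) (g 0) (h 0)
  where open +-*-Solver
⊛-assoc f g h .at (suc n) = begin
  (f ⊛ g) 0 ℤ.* h (suc n) ℤ.+ (((f 0 · (g ∘ suc)) ⊕ ((f ∘ suc) ⊛ g)) ⊛ h) n
    ≡⟨ cong (ℤ._+_ ((f ⊛ g) 0 ℤ.* h (suc n))) (⊛-distribʳ (f 0 · (g ∘ suc)) ((f ∘ suc) ⊛ g) h .at n) ⟩
  (f ⊛ g) 0 ℤ.* h (suc n) ℤ.+ (((f 0 · (g ∘ suc)) ⊛ h) n ℤ.+ (((f ∘ suc) ⊛ g) ⊛ h) n)
    ≡⟨ cong (ℤ._+_ ((f ⊛ g) 0 ℤ.* h (suc n)))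
         (cong₂ ℤ._+_ (·-⊛ (f 0) (g ∘ suc) h .at n) (⊛-assoc (f ∘ suc) g h .at n)) ⟩
  (f ⊛ g) 0 ℤ.* h (suc n) ℤ.+ (f 0 ℤ.* ((g ∘ suc) ⊛ h) n ℤ.+ ((f ∘ suc) ⊛ (g ⊛ h)) n)
    ≡⟨ solve 5 (λ x y z u v → (x :* y :+ con 0ℤ) :* z :+ (x :* u :+ v) := x :* (y :* z :+ u) :+ v)
         refl (f 0) (g 0) (h (suc n)) _ _ ⟩
  f 0 ℤ.* (g ⊛ h) (suc n) ℤ.+ ((f ∘ suc) ⊛ (g ⊛ h)) n ∎
  where
  open +-*-Solver
  open ≡-Reasoning

⊛-identityˡ : ∀ f → 1ₛ ⊛ f ≈ f
⊛-identityˡ f = ≈-trans (⊛-comm 1ₛ f) (pointwise (⊛-identityʳ f))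

seriesRing : CommutativeRing 0ℓ 0ℓ
seriesRing = record
  { Carrier = Series ; _≈_ = _≈_ ; _+_ = _⊕_ ; _*_ = _⊛_ ; -_ = ⊝_ ; 0# = 0ₛ ; 1# = 1ₛ
  ; isCommutativeRing = record
    { isRing = record
      { +-isAbelianGroup = record
        { isGroup = record
          { isMonoid = record
            { isSemigroup = record
              { isMagma = record
                { isEquivalence = record { refl = ≈-refl ; sym = ≈-sym ; trans = ≈-trans }
                ; ∙-cong = λ p q → pointwise λ n → cong₂ ℤ._+_ (p .at n) (q .at n) }
              ; assoc = λ f g h → pointwise λ n → ℤ.+-assoc (f n) (g n) (h n) }
            ; identity = (λ f → pointwise λ n → ℤ.+-identityˡ (f n))
                       , (λ f → pointwise λ n → ℤ.+-identityʳ (f n)) }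
          ; inverse = (λ f → pointwise λ n → ℤ.+-inverseˡ (f n))
                    , (λ f → pointwise λ n → ℤ.+-inverseʳ (f n))
          ; ⁻¹-cong = λ p → pointwise λ n → cong ℤ.-_ (p .at n) }
        ; comm = λ f g → pointwise λ n → ℤ.+-comm (f n) (g n) }
      ; *-cong = ⊛-cong
      ; *-assoc = ⊛-assoc
      ; *-identity = ⊛-identityˡ , (λ f → pointwise (⊛-identityʳ f))
      ; distrib = (λ f g h → ≈-trans (⊛-comm f (g ⊕ h)) (≈-trans (⊛-distribʳ g h f)
                    (pointwise λ n → cong₂ ℤ._+_ (⊛-comm g f .at n) (⊛-comm h f .at n))))
                , (λ f g h → ⊛-distribʳ g h f) }
    ; *-comm = ⊛-comm } }

open CommutativeRing seriesRing public
  using () renaming (+-cong to ⊕-cong; setoid to ≈-setoid; -‿cong to ⊝-cong)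

module ≈-Reasoning = SetoidReasoning ≈-setoid

⊖-cong : ∀ {f f′ g g′} → f ≈ f′ → g ≈ g′ → f ⊖ g ≈ f′ ⊖ g′
⊖-cong p q .at n = cong₂ ℤ._-_ (p .at n) (q .at n)

·-cong : ∀ c {f g} → f ≈ g → c · f ≈ c · g
·-cong c p .at n = cong (c ℤ.*_) (p .at n)

const-·1 : ∀ c → const c ≈ c · 1ₛ
const-·1 (ℤ.+ 0)             .at n = sym (ℤ.*-zeroˡ (1ₛ n))
const-·1 (ℤ.+ 1)             .at n = sym (ℤ.*-identityˡ (1ₛ n))
const-·1 (ℤ.+ (suc (suc _))) .at n = refl
const-·1 (ℤ.-[1+ _ ])      .at n = refl

const-⊛ : ∀ c f → const c ⊛ f ≈ c · f
const-⊛ c f = begin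
  const c ⊛ f       ≈⟨ ⊛-congʳ f (const-·1 c) ⟩
  (c · 1ₛ) ⊛ f      ≈⟨ ·-⊛ c 1ₛ f ⟩
  c · (1ₛ ⊛ f)      ≈⟨ ·-cong c (⊛-identityˡ f) ⟩
  c · f             ∎
  where open ≈-Reasoning

const-homomorphism : CommutativeRing.rawRing ℤ.+-*-commutativeRing
                     -Raw-AlmostCommutative⟶ fromCommutativeRing seriesRing
const-homomorphism = record
  { ⟦_⟧    = const
  ; +-homo = λ c d → ≈-trans (const-·1 (c ℤ.+ d)) (≈-sym (≈-trans (⊕-cong (const-·1 c) (const-·1 d))
               (pointwise λ n → sym (ℤ.*-distribʳ-+ (1ₛ n) c d))))
  ; *-homo = λ c d → ≈-trans (const-·1 (c ℤ.* d)) (≈-sym (≈-trans (const-⊛ c (const d))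
               (≈-trans (·-cong c (const-·1 d)) (pointwise λ n → sym (ℤ.*-assoc c d (1ₛ n))))))
  ; -‿homo = λ c → ≈-trans (const-·1 (ℤ.- c)) (≈-sym (≈-trans (⊝-cong (const-·1 c))
               (pointwise λ n → ℤ.neg-distribˡ-* c (1ₛ n))))
  ; 0-homo = ≈-refl
  ; 1-homo = ≈-refl }

open _-Raw-AlmostCommutative⟶_ const-homomorphism public
  using () renaming (+-homo to const-⊕; *-homo to const-⊛-const; -‿homo to const-⊝)

const-≟ : ∀ c d → Maybe (const c ≈ const d)
const-≟ c d with c ℤ.≟ d
... | yes refl = just ≈-refl
... | no  _    = nothing

module S = Algebra.Solver.Ring (CommutativeRing.rawRing ℤ.+-*-commutativeRing)
  (fromCommutativeRing seriesRing) const-homomorphism const-≟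

⊛-interchange : ∀ f g h k → (f ⊛ g) ⊛ (h ⊛ k) ≈ (f ⊛ h) ⊛ (g ⊛ k)
⊛-interchange = S.solve 4 (λ f g h k → (f S.:* g) S.:* (h S.:* k) S.:= (f S.:* h) S.:* (g S.:* k)) ≈-refl

⊛-interchange₃ : ∀ f g h f′ g′ h′ → (f ⊛ g ⊛ h) ⊛ (f′ ⊛ g′ ⊛ h′) ≈ (f ⊛ f′) ⊛ (g ⊛ g′) ⊛ (h ⊛ h′)
⊛-interchange₃ f g h f′ g′ h′ = ≈-trans (⊛-interchange (f ⊛ g) h (f′ ⊛ g′) h′)
  (⊛-congʳ (h ⊛ h′) {(f ⊛ g) ⊛ (f′ ⊛ g′)} {(f ⊛ f′) ⊛ (g ⊛ g′)} (⊛-interchange f g f′ g′))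

≡⇒≈ : ∀ {f g : Series} → f ≡ g → f ≈ g
≡⇒≈ refl = ≈-refl

q^-cong : ∀ {a b} → a ≡ b → q^ a ≈ q^ b
q^-cong = ≡⇒≈ ∘ cong q^_

q^-⊛-< : ∀ e f n → n < e → (q^ e ⊛ f) n ≡ 0ℤ
q^-⊛-< (suc e) f zero    _         = trans (ℤ.+-identityʳ _) (ℤ.*-zeroˡ (f 0))
q^-⊛-< (suc e) f (suc n) (s≤s n<e) =
  trans (cong₂ ℤ._+_ (ℤ.*-zeroˡ (f (suc n))) (q^-⊛-< e f n n<e)) refl

q^-⊛-+ : ∀ e f n → (q^ e ⊛ f) (e + n) ≡ f n
q^-⊛-+ zero    f n = ⊛-identityˡ f .at n
q^-⊛-+ (suc e) f n =
  trans (cong₂ ℤ._+_ (ℤ.*-zeroˡ (f (suc (e + n)))) (q^-⊛-+ e f n)) (ℤ.+-identityˡ (f n))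

q^-+ : ∀ a b → q^ a ⊛ q^ b ≈ q^ (a + b)
q^-+ zero    b = ⊛-identityˡ (q^ b)
q^-+ (suc a) b .at zero    = trans (ℤ.+-identityʳ _) (ℤ.*-zeroˡ ((q^ b) 0))
q^-+ (suc a) b .at (suc n) = trans (cong₂ ℤ._+_ (ℤ.*-zeroˡ ((q^ b) (suc n))) (q^-+ a b .at n)) (ℤ.+-identityˡ _)

1−q^_ : ℕ → Series
1−q^ e = 1ₛ ⊖ q^ e

-- Congruence modulo q^N

infix 4 _≈_mod-q^_

record _≈_mod-q^_ (f g : Series) (N : ℕ) : Set where
  constructor below
  field at : ∀ n → n < N → f n ≡ g n

open _≈_mod-q^_ renaming (at to at<)

module _ {N : ℕ} where

  ≈⇒mod : ∀ {f g} → f ≈ g → f ≈ g mod-q^ N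
  ≈⇒mod p .at< n _ = p .at n

  mod-refl : ∀ {f} → f ≈ f mod-q^ N
  mod-refl .at< _ _ = refl

  mod-sym : ∀ {f g} → f ≈ g mod-q^ N → g ≈ f mod-q^ N
  mod-sym p .at< n n<N = sym (p .at< n n<N)

  mod-trans : ∀ {f g h} → f ≈ g mod-q^ N → g ≈ h mod-q^ N → f ≈ h mod-q^ N
  mod-trans p r .at< n n<N = trans (p .at< n n<N) (r .at< n n<N)

  ⊕-mod : ∀ {f f′ g g′} → f ≈ f′ mod-q^ N → g ≈ g′ mod-q^ N → f ⊕ g ≈ f′ ⊕ g′ mod-q^ N
  ⊕-mod p r .at< n n<N = cong₂ ℤ._+_ (p .at< n n<N) (r .at< n n<N)

  ⊛-mod : ∀ {f f′ g g′} → f ≈ f′ mod-q^ N → g ≈ g′ mod-q^ N → f ⊛ g ≈ f′ ⊛ g′ mod-q^ N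
  ⊛-mod p r .at< n n<N = ⊛-congₙ n (λ i i≤n → p .at< i (ℕ.≤-<-trans i≤n n<N))
                                    (λ i i≤n → r .at< i (ℕ.≤-<-trans i≤n n<N))

  ⊛-modˡ : ∀ f {g g′} → g ≈ g′ mod-q^ N → f ⊛ g ≈ f ⊛ g′ mod-q^ N
  ⊛-modˡ f p = ⊛-mod (mod-refl {f}) p

  ⊛-modʳ : ∀ g {f f′} → f ≈ f′ mod-q^ N → f ⊛ g ≈ f′ ⊛ g mod-q^ N
  ⊛-modʳ g p = ⊛-mod p (mod-refl {g})

  q^-mod-0 : ∀ e f → N ≤ e → q^ e ⊛ f ≈ 0ₛ mod-q^ N
  q^-mod-0 e f N≤e .at< n n<N = q^-⊛-< e f n (ℕ.<-≤-trans n<N N≤e)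

  1−q^-mod : ∀ e → N ≤ e → 1−q^ e ≈ 1ₛ mod-q^ N
  1−q^-mod e N≤e .at< n n<N =
    trans (cong (λ x → 1ₛ n ℤ.- x) (q^-≡0 e n (ℕ.<-≤-trans n<N N≤e))) (ℤ.+-identityʳ (1ₛ n))

mod-weaken : ∀ {M N f g} → M ≤ N → f ≈ g mod-q^ N → f ≈ g mod-q^ M
mod-weaken M≤N p .at< n n<M = p .at< n (ℕ.<-≤-trans n<M M≤N)

-- This is how identities between limits are derived: modulo `q^N` a limit may be replaced by a
-- finite sum or product.
mod⇒≈ : ∀ {f g} → (∀ N → f ≈ g mod-q^ N) → f ≈ g
mod⇒≈ p .at n = p (suc n) .at< n ℕ.≤-refl

-- Inverses of series with constant term 1

inv : Series → Series
inv g = 1ₛ ⊘ g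

inv-inverseˡ : ∀ g → g 0 ≡ 1ℤ → inv g ⊛ g ≈ 1ₛ
inv-inverseˡ g g₀ .at = ⊘-⊛ 1ₛ g g₀

inv-unique : ∀ g h → g 0 ≡ 1ℤ → h ⊛ g ≈ 1ₛ → h ≈ inv g
inv-unique g h g₀ p .at = ⊘-unique 1ₛ g h g₀ (p .at)

⊘≈⊛inv : ∀ f g → g 0 ≡ 1ℤ → f ⊘ g ≈ f ⊛ inv g
⊘≈⊛inv f g g₀ = ≈-sym (pointwise (⊘-unique f g (f ⊛ inv g) g₀ (eq .at)))
  where
  eq : (f ⊛ inv g) ⊛ g ≈ f
  eq = ≈-trans (⊛-assoc f (inv g) g) (≈-trans (⊛-congˡ f (inv-inverseˡ g g₀)) (pointwise (⊛-identityʳ f)))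

⊛-0 : ∀ f g → f 0 ≡ 1ℤ → g 0 ≡ 1ℤ → (f ⊛ g) 0 ≡ 1ℤ
⊛-0 f g f₀ g₀ rewrite f₀ | g₀ = refl

inv-⊛ : ∀ f g → f 0 ≡ 1ℤ → g 0 ≡ 1ℤ → inv (f ⊛ g) ≈ inv f ⊛ inv g
inv-⊛ f g f₀ g₀ = ≈-sym (inv-unique (f ⊛ g) (inv f ⊛ inv g) (⊛-0 f g f₀ g₀) (begin
  (inv f ⊛ inv g) ⊛ (f ⊛ g)  ≈⟨ ⊛-interchange (inv f) (inv g) f g ⟩
  (inv f ⊛ f) ⊛ (inv g ⊛ g)  ≈⟨ ⊛-cong (inv-inverseˡ f f₀) (inv-inverseˡ g g₀) ⟩
  1ₛ ⊛ 1ₛ                    ≈⟨ ⊛-identityˡ 1ₛ ⟩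
  1ₛ                         ∎))
  where
  open ≈-Reasoning

-- Write `inv f` as `inv g ⊛ g ⊛ inv f`, replace `g` by `f` and cancel it against `inv f`.
inv-mod : ∀ {N f g} → f 0 ≡ 1ℤ → g 0 ≡ 1ℤ → f ≈ g mod-q^ N → inv f ≈ inv g mod-q^ N
inv-mod {N} {f} {g} f₀ g₀ p =
  mod-trans (≈⇒mod (≈-sym (≈-trans (⊛-congʳ (inv f) (inv-inverseˡ g g₀)) (⊛-identityˡ (inv f)))))
  (mod-trans (⊛-modʳ (inv f) (⊛-modˡ (inv g) (mod-sym p)))
  (≈⇒mod (begin
    (inv g ⊛ f) ⊛ inv f
      ≈⟨ solve 3 (λ a b c → (a :* b) :* c := a :* (c :* b)) ≈-refl (inv g) f (inv f) ⟩
    inv g ⊛ (inv f ⊛ f) ≈⟨ ⊛-congˡ (inv g) (inv-inverseˡ f f₀) ⟩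
    inv g ⊛ 1ₛ          ≈⟨ pointwise (⊛-identityʳ (inv g)) ⟩
    inv g               ∎)))
  where
  open S
  open ≈-Reasoning

1−q^-0 : ∀ e → 1 ≤ e → (1−q^ e) 0 ≡ 1ℤ
1−q^-0 (suc e) _ = refl

-- Sums and products

Σ-cong : ∀ {t u} n → (∀ i → i < n → t i ≈ u i) → partialSum t 0 n ≈ partialSum u 0 n
Σ-cong zero    p = ≈-refl
Σ-cong (suc n) p = ⊕-cong (Σ-cong n λ i i<n → p i (ℕ.m≤n⇒m≤1+n i<n)) (p n ℕ.≤-refl)

Σ-mod : ∀ {N t u} n → (∀ i → i < n → t i ≈ u i mod-q^ N) →
        partialSum t 0 n ≈ partialSum u 0 n mod-q^ N
Σ-mod zero    p = mod-refl
Σ-mod (suc n) p = ⊕-mod (Σ-mod n λ i i<n → p i (ℕ.m≤n⇒m≤1+n i<n)) (p n ℕ.≤-refl)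

Σ-front : ∀ t n → partialSum t 0 (suc n) ≈ t 0 ⊕ partialSum (t ∘ suc) 0 n
Σ-front t zero    = solve 1 (λ x → con 0ℤ :+ x := x :+ con 0ℤ) ≈-refl (t 0)
  where open S
Σ-front t (suc n) = ≈-trans (⊕-cong (Σ-front t n) ≈-refl)
  (solve 3 (λ x y z → x :+ y :+ z := x :+ (y :+ z)) ≈-refl (t 0) (partialSum (t ∘ suc) 0 n) (t (suc n)))
  where open S

Σ-⊕ : ∀ t u n → partialSum (λ i → t i ⊕ u i) 0 n ≈ partialSum t 0 n ⊕ partialSum u 0 n
Σ-⊕ t u zero    .at m = refl
Σ-⊕ t u (suc n) = ≈-trans (⊕-cong (Σ-⊕ t u n) ≈-refl)
  (solve 4 (λ a b c d → (a :+ b) :+ (c :+ d) := (a :+ c) :+ (b :+ d)) ≈-refl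
    (partialSum t 0 n) (partialSum u 0 n) (t n) (u n))
  where open S

Σ-⊛ : ∀ f t n → f ⊛ partialSum t 0 n ≈ partialSum (λ i → f ⊛ t i) 0 n
Σ-⊛ f t zero    = solve 1 (λ f → f :* con 0ℤ := con 0ℤ) ≈-refl f
  where open S
Σ-⊛ f t (suc n) = ≈-trans
  (solve 3 (λ f a b → f :* (a :+ b) := f :* a :+ f :* b) ≈-refl f (partialSum t 0 n) (t n))
  (⊕-cong (Σ-⊛ f t n) ≈-refl)
  where open S

Σ-split : ∀ t k n → partialSum t 0 (k + n) ≈ partialSum t 0 k ⊕ partialSum t k n
Σ-split t k zero    = ≈-trans (≡⇒≈ (cong (partialSum t 0) (ℕ.+-identityʳ k)))
  (solve 1 (λ x → x := x :+ con 0ℤ) ≈-refl (partialSum t 0 k))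
  where open S
Σ-split t k (suc n) = ≈-trans (≡⇒≈ (cong (partialSum t 0) (ℕ.+-suc k n)))
  (≈-trans (⊕-cong (Σ-split t k n) ≈-refl)
  (solve 3 (λ x y z → x :+ y :+ z := x :+ (y :+ z)) ≈-refl (partialSum t 0 k) (partialSum t k n) (t (k + n))))
  where open S

Π-cong : ∀ {f g} n → (∀ i → f i ≈ g i) → partialProduct f n ≈ partialProduct g n
Π-cong zero    p = ≈-refl
Π-cong (suc n) p = ⊛-cong (Π-cong n p) (p n)

Π-front : ∀ f n → partialProduct f (suc n) ≈ f 0 ⊛ partialProduct (f ∘ suc) n
Π-front f zero    = ⊛-comm 1ₛ (f 0)
Π-front f (suc n) = ≈-trans (⊛-congʳ (f (suc n)) (Π-front f n)) (⊛-assoc (f 0) (partialProduct (f ∘ suc) n) (f (suc n)))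

Π-0 : ∀ f n → (∀ i → f i 0 ≡ 1ℤ) → partialProduct f n 0 ≡ 1ℤ
Π-0 f zero    p = refl
Π-0 f (suc n) p = ⊛-0 (partialProduct f n) (f n) (Π-0 f n p) (p n)

Π-inv : ∀ f n → (∀ i → f i 0 ≡ 1ℤ) → inv (partialProduct f n) ≈ partialProduct (inv ∘ f) n
Π-inv f zero    p = ≈-sym (inv-unique 1ₛ 1ₛ refl (⊛-identityˡ 1ₛ))
Π-inv f (suc n) p = ≈-trans (inv-⊛ (partialProduct f n) (f n) (Π-0 f n p) (p n)) (⊛-congʳ (inv (f n)) (Π-inv f n p))

qPochhammer-mod : ∀ {N} a b n → 1 ≤ a → 1 ≤ b → N ≤ n →
                  partialProduct (qFactor a b) n ≈ qPochhammer a b mod-q^ N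
qPochhammer-mod a (suc b) n 1≤a 1≤b N≤n .at< m m<N =
  proj₂ (⟶-qPochhammer a (suc b) 1≤a 1≤b m) n (ℕ.<-≤-trans m<N N≤n)

qFactor-0 : ∀ a b i → 1 ≤ a → qFactor a b i 0 ≡ 1ℤ
qFactor-0 a b i 1≤a = 1−q^-0 (a + b * i) (ℕ.≤-trans 1≤a (ℕ.m≤m+n a (b * i)))

qPochhammer-step : ∀ a b → 1 ≤ a → 1 ≤ b → qPochhammer a b ≈ 1−q^ a ⊛ qPochhammer (a + b) b
qPochhammer-step a b 1≤a 1≤b = mod⇒≈ λ N →
  mod-trans (mod-sym (qPochhammer-mod a b (suc N) 1≤a 1≤b (ℕ.n≤1+n N)))
  (mod-trans (≈⇒mod (Π-front (qFactor a b) N))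
  (⊛-mod (≈⇒mod (factor a (solve 2 (λ a b → a :+ b :* con 0 := a) refl a b)))
  (mod-trans (≈⇒mod (Π-cong N λ i → factor (a + b + b * i)
     (solve 3 (λ a b i → a :+ b :* (con 1 :+ i) := a :+ b :+ b :* i) refl a b i)))
  (qPochhammer-mod (a + b) b N (ℕ.≤-trans 1≤a (ℕ.m≤m+n a b)) 1≤b ℕ.≤-refl))))
  where
  open ℕ-Solver
  factor : ∀ e {e′} → e′ ≡ e → 1−q^ e′ ≈ 1−q^ e
  factor e refl = ≈-refl

-- The Jacobi triple product

sgn : ℕ → Series
sgn zero    = 1ₛ
sgn (suc n) = ⊝ sgn n

-1^-sgn : ∀ j → const (-1ℤ ℤ.^ j) ≈ sgn j
-1^-sgn zero    = ≈-refl
-1^-sgn (suc j) = begin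
  const (-1ℤ ℤ.* c)  ≈⟨ ≡⇒≈ (cong const (ℤ.-1*i≡-i c)) ⟩
  const (ℤ.- c)      ≈⟨ const-⊝ c ⟩
  ⊝ const c          ≈⟨ ⊝-cong (-1^-sgn j) ⟩
  ⊝ sgn j            ∎
  where
  c = -1ℤ ℤ.^ j
  open ≈-Reasoning

-- The number `n (n - 1) / 2`, by recursion to avoid the division.
tri : ℕ → ℕ
tri zero    = 0
tri (suc n) = tri n + n

module Gauss (r : ℕ) where

  R^_ : ℕ → Series
  R^ n = q^ (r * n)

  R^-+ : ∀ m n → R^ m ⊛ R^ n ≈ R^ (m + n)
  R^-+ m n = ≈-trans (q^-+ (r * m) (r * n)) (q^-cong (sym (ℕ.*-distribˡ-+ r m n)))

  -- The Gaussian binomial coefficient in base `q^r`, defined by one of its two Pascal rules and so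
  -- without division.
  gauss : ℕ → ℕ → Series
  gauss _       zero    = 1ₛ
  gauss zero    (suc i) = 0ₛ
  gauss (suc n) (suc i) = gauss n i ⊕ R^ suc i ⊛ gauss n (suc i)

  gauss-< : ∀ n i → n < i → gauss n i ≈ 0ₛ
  gauss-< zero    (suc i) _         = ≈-refl
  gauss-< (suc n) (suc i) (s≤s n<i) = begin
    gauss n i ⊕ R^ suc i ⊛ gauss n (suc i)
      ≈⟨ ⊕-cong (gauss-< n i n<i) (⊛-congˡ (R^ suc i) (gauss-< n (suc i) (ℕ.m≤n⇒m≤1+n n<i))) ⟩
    0ₛ ⊕ R^ suc i ⊛ 0ₛ
      ≈⟨ solve 1 (λ x → con 0ℤ :+ x :* con 0ℤ := con 0ℤ) ≈-refl (R^ suc i) ⟩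
    0ₛ ∎
    where
    open S
    open ≈-Reasoning

  -- The second Pascal rule, with the weight on the other summand. Writing the upper index as
  -- `i + d` avoids a subtraction in the exponent.
  gauss-pascal : ∀ i d → gauss (suc (i + d)) (suc i) ≈ gauss (i + d) (suc i) ⊕ R^ d ⊛ gauss (i + d) i
  gauss-pascal i zero rewrite ℕ.+-identityʳ i | ℕ.*-zeroʳ r = begin
    gauss i i ⊕ R^ suc i ⊛ gauss i (suc i)
      ≈⟨ ⊕-cong (≈-refl {gauss i i}) (⊛-congˡ (R^ suc i) (gauss-< i (suc i) ℕ.≤-refl)) ⟩
    gauss i i ⊕ R^ suc i ⊛ 0ₛ
      ≈⟨ solve 2 (λ x y → x :+ y :* con 0ℤ := con 0ℤ :+ con 1ℤ :* x) ≈-refl (gauss i i) (R^ suc i) ⟩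
    0ₛ ⊕ 1ₛ ⊛ gauss i i
      ≈⟨ ⊕-cong (gauss-< i (suc i) ℕ.≤-refl) (≈-refl {1ₛ ⊛ gauss i i}) ⟨
    gauss i (suc i) ⊕ 1ₛ ⊛ gauss i i ∎
    where
    open S
    open ≈-Reasoning
  gauss-pascal zero (suc d) = begin
    1ₛ ⊕ R^ 1 ⊛ gauss (suc d) 1
      ≈⟨ ⊕-cong (≈-refl {1ₛ}) (⊛-congˡ (R^ 1) (gauss-pascal zero d)) ⟩
    1ₛ ⊕ R^ 1 ⊛ (gauss d 1 ⊕ R^ d ⊛ 1ₛ)
      ≈⟨ solve 3 (λ x y z → con 1ℤ :+ x :* (y :+ z :* con 1ℤ) := con 1ℤ :+ x :* y :+ x :* z)
           ≈-refl (R^ 1) (gauss d 1) (R^ d) ⟩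
    1ₛ ⊕ R^ 1 ⊛ gauss d 1 ⊕ R^ 1 ⊛ R^ d
      ≈⟨ ⊕-cong (≈-refl {gauss (suc d) 1}) (≈-trans (R^-+ 1 d) (≈-sym (pointwise (⊛-identityʳ (R^ suc d))))) ⟩
    gauss (suc d) 1 ⊕ R^ suc d ⊛ 1ₛ ∎
    where
    open S
    open ≈-Reasoning
  gauss-pascal (suc i) (suc d) = begin
    gauss (suc n) (suc i) ⊕ R^ suc (suc i) ⊛ gauss (suc n) (suc (suc i))
      ≈⟨ ⊕-cong (gauss-pascal i (suc d)) (⊛-congˡ (R^ suc (suc i)) ih) ⟩
    (g₁ ⊕ R^ suc d ⊛ g₀) ⊕ R^ suc (suc i) ⊛ (g₂ ⊕ R^ d ⊛ g₁)
      ≈⟨ solve 6 (λ g₀ g₁ g₂ x y z → (g₁ :+ x :* g₀) :+ y :* (g₂ :+ z :* g₁)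
                                  := (g₁ :+ y :* g₂) :+ (x :* g₀ :+ y :* z :* g₁))
           ≈-refl g₀ g₁ g₂ (R^ suc d) (R^ suc (suc i)) (R^ d) ⟩
    (g₁ ⊕ R^ suc (suc i) ⊛ g₂) ⊕ (R^ suc d ⊛ g₀ ⊕ R^ suc (suc i) ⊛ R^ d ⊛ g₁)
      ≈⟨ ⊕-cong (≈-refl {gauss (suc n) (suc (suc i))})
           (⊕-cong (≈-refl {R^ suc d ⊛ g₀}) (⊛-congʳ g₁ exponents)) ⟩
    (g₁ ⊕ R^ suc (suc i) ⊛ g₂) ⊕ (R^ suc d ⊛ g₀ ⊕ R^ suc d ⊛ R^ suc i ⊛ g₁)
      ≈⟨ solve 5 (λ a g₀ g₁ x y → a :+ (x :* g₀ :+ x :* y :* g₁) := a :+ x :* (g₀ :+ y :* g₁))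
           ≈-refl (gauss (suc n) (suc (suc i))) g₀ g₁ (R^ suc d) (R^ suc i) ⟩
    gauss (suc n) (suc (suc i)) ⊕ R^ suc d ⊛ gauss (suc n) (suc i) ∎
    where
    n = i + suc d
    g₀ = gauss n i
    g₁ = gauss n (suc i)
    g₂ = gauss n (suc (suc i))
    open S
    open ≈-Reasoning
    ih : gauss (suc n) (suc (suc i)) ≈ g₂ ⊕ R^ d ⊛ g₁
    ih = subst (λ m → gauss (suc m) (suc (suc i)) ≈ gauss m (suc (suc i)) ⊕ R^ d ⊛ gauss m (suc i))
           (sym (ℕ.+-suc i d)) (gauss-pascal (suc i) d)
    exponents : R^ suc (suc i) ⊛ R^ d ≈ R^ suc d ⊛ R^ suc i
    exponents = ≈-trans (R^-+ (suc (suc i)) d) (≈-trans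
      (q^-cong (cong (r *_) (ℕS.solve 2 (λ i d → ℕS.con 2 ℕS.:+ i ℕS.:+ d ℕS.:= ℕS.con 1 ℕS.:+ d ℕS.:+ (ℕS.con 1 ℕS.:+ i)) refl i d)))
      (≈-sym (R^-+ (suc d) (suc i))))
      where module ℕS = ℕ-Solver

  -- Apply the defining Pascal rule to one copy of `g` and `gauss-pascal` to the other; `g₁`
  -- cancels. This takes the place of the quotient formula.
  gauss-absorption : ∀ i d → 1−q^ (r * suc i) ⊛ gauss (suc (i + d)) (suc i) ≈
                             1−q^ (r * suc (i + d)) ⊛ gauss (i + d) i
  gauss-absorption i d = begin
    1−q^ (r * suc i) ⊛ g
      ≈⟨ solve 2 (λ x g → (con 1ℤ :- x) :* g := g :- x :* g) ≈-refl (R^ suc i) g ⟩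
    g ⊖ R^ suc i ⊛ g
      ≈⟨ ⊖-cong (≈-refl {g}) (⊛-congˡ (R^ suc i) (gauss-pascal i d)) ⟩
    (g₀ ⊕ R^ suc i ⊛ g₁) ⊖ R^ suc i ⊛ (g₁ ⊕ R^ d ⊛ g₀)
      ≈⟨ solve 4 (λ g₀ g₁ x y → (g₀ :+ x :* g₁) :- x :* (g₁ :+ y :* g₀) := (con 1ℤ :- x :* y) :* g₀)
           ≈-refl g₀ g₁ (R^ suc i) (R^ d) ⟩
    (1ₛ ⊖ R^ suc i ⊛ R^ d) ⊛ g₀
      ≈⟨ ⊛-congʳ g₀ (⊖-cong (≈-refl {1ₛ}) (R^-+ (suc i) d)) ⟩
    1−q^ (r * suc (i + d)) ⊛ g₀ ∎
    where
    g  = gauss (suc (i + d)) (suc i)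
    g₀ = gauss (i + d) i
    g₁ = gauss (i + d) (suc i)
    open S
    open ≈-Reasoning

  module _ (1≤r : 1 ≤ r) where

    -- With `Q = q^r` the product is `(1 - Q^(d+1)) ⋯ (1 - Q^(d+i))`, and each of these factors is 1
    -- modulo `q^(d+1)`.
    Π⊛gauss-mod : ∀ i d → partialProduct (qFactor r r) i ⊛ gauss (i + d) i ≈ 1ₛ mod-q^ suc d
    Π⊛gauss-mod zero    d = ≈⇒mod (⊛-identityˡ 1ₛ)
    Π⊛gauss-mod (suc i) d = mod-trans
      (≈⇒mod (begin
        P ⊛ qFactor r r i ⊛ gauss (suc (i + d)) (suc i)
          ≈⟨ ⊛-assoc P (qFactor r r i) (gauss (suc (i + d)) (suc i)) ⟩
        P ⊛ (qFactor r r i ⊛ gauss (suc (i + d)) (suc i))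
          ≈⟨ ⊛-congˡ P (⊛-congʳ (gauss (suc (i + d)) (suc i)) (≡⇒≈ (cong 1−q^_ (sym (ℕ.*-suc r i))))) ⟩
        P ⊛ (1−q^ (r * suc i) ⊛ gauss (suc (i + d)) (suc i))
          ≈⟨ ⊛-congˡ P (gauss-absorption i d) ⟩
        P ⊛ (1−q^ (r * suc (i + d)) ⊛ gauss (i + d) i) ∎))
      (mod-trans (⊛-modˡ P (⊛-modʳ (gauss (i + d) i)
        (1−q^-mod (r * suc (i + d)) (ℕ.≤-trans (s≤s (ℕ.m≤n+m d i)) (ℕ.m≤n*m (suc (i + d)) r {{>-nonZero 1≤r}})))))
      (mod-trans (⊛-modˡ P (≈⇒mod (⊛-identityˡ (gauss (i + d) i)))) (Π⊛gauss-mod i d)))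
      where
      P = partialProduct (qFactor r r) i
      open ≈-Reasoning

    -- In the limit of large `i` and `d` the Gaussian binomial coefficient is the reciprocal of
    -- `(q^r; q^r)_∞`.
    E⊛gauss-mod : ∀ {K} i d → K ≤ i → K ≤ suc d → qPochhammer r r ⊛ gauss (i + d) i ≈ 1ₛ mod-q^ K
    E⊛gauss-mod i d K≤i K≤1+d = mod-trans
      (⊛-modʳ (gauss (i + d) i) (mod-sym (qPochhammer-mod r r i 1≤r 1≤r K≤i)))
      (mod-weaken K≤1+d (Π⊛gauss-mod i d))

module TripleProduct (s a : ℕ) (1≤s : 1 ≤ s) (1≤a : 1 ≤ a) where

  r : ℕ
  r = s + a

  1≤r : 1 ≤ r
  1≤r = ℕ.≤-trans 1≤s (ℕ.m≤m+n s a)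

  open Gauss r

  -- s j + r j (j - 1) / 2 for the integer j = i - l.
  bilateral : ℕ → ℕ → ℕ
  bilateral zero    i       = s * i + r * tri i
  bilateral (suc l) zero    = a * suc l + r * tri (suc l)
  bilateral (suc l) (suc i) = bilateral l i

  bilateral-0 : ∀ l → bilateral l 0 ≡ a * l + r * tri l
  bilateral-0 zero    = cong (_+ r * 0) (trans (ℕ.*-zeroʳ s) (sym (ℕ.*-zeroʳ a)))
  bilateral-0 (suc l) = refl

  -- From `j` to `j + 1` the exponent changes by `s + r j`. Here `j = i - l` enters as `x - y`,
  -- which keeps both sides free of subtraction.
  bilateral-sucʳ : ∀ l i x y → x + l ≡ y + i →
                   s + r * x + bilateral l i ≡ r * y + bilateral l (suc i)
  bilateral-sucʳ zero i x y eq rewrite trans (sym (ℕ.+-identityʳ x)) eq =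
    solve 5 (λ s r i y t → s :+ r :* (y :+ i) :+ (s :* i :+ r :* t)
                        := r :* y :+ (s :* (con 1 :+ i) :+ r :* (t :+ i))) refl s r i y (tri i)
    where open ℕ-Solver
  bilateral-sucʳ (suc l) zero x y eq rewrite trans (sym (ℕ.+-identityʳ y)) (sym eq) | bilateral-0 l =
    solve 5 (λ s a l x t → s :+ (s :+ a) :* x :+ (a :* (con 1 :+ l) :+ (s :+ a) :* (t :+ l))
                        := (s :+ a) :* (x :+ (con 1 :+ l)) :+ (a :* l :+ (s :+ a) :* t)) refl s a l x (tri l)
    where open ℕ-Solver
  bilateral-sucʳ (suc l) (suc i) x y eq =
    bilateral-sucʳ l i x y (ℕ.suc-injective (trans (sym (ℕ.+-suc x l)) (trans eq (ℕ.+-suc y i))))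

  bilateral-sucˡ : ∀ l i → a + r * l + bilateral l i ≡ r * i + bilateral (suc l) i
  bilateral-sucˡ l zero rewrite bilateral-0 l =
    solve 4 (λ a r l t → a :+ r :* l :+ (a :* l :+ r :* t) := r :* con 0 :+ (a :* (con 1 :+ l) :+ r :* (t :+ l)))
      refl a r l (tri l)
    where open ℕ-Solver
  bilateral-sucˡ l (suc i) = begin
    a + r * l + bilateral l (suc i)     ≡⟨ ℕ.+-assoc a (r * l) _ ⟩
    a + (r * l + bilateral l (suc i))   ≡⟨ cong (a +_) (bilateral-sucʳ l i i l (ℕ.+-comm i l)) ⟨
    a + (s + r * i + bilateral l i)     ≡⟨ solve 4 (λ a s i b → a :+ (s :+ (s :+ a) :* i :+ b)
                                                             := (s :+ a) :* (con 1 :+ i) :+ b) refl a s i (bilateral l i) ⟩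
    r * suc i + bilateral l i           ∎
    where
    open ℕ-Solver
    open ≡-Reasoning

  -- With the next lemma: the exponent is at least `|i - l|`, so a term that is visible below `q^K`
  -- has `i` within `K` of `l`.
  i≤l+bilateral : ∀ l i → i ≤ l + bilateral l i
  i≤l+bilateral zero    i       = ℕ.≤-trans (ℕ.m≤n*m i s {{>-nonZero 1≤s}}) (ℕ.m≤m+n (s * i) _)
  i≤l+bilateral (suc l) zero    = z≤n
  i≤l+bilateral (suc l) (suc i) = s≤s (i≤l+bilateral l i)

  l≤i+bilateral : ∀ l i → l ≤ i + bilateral l i
  l≤i+bilateral zero    i       = z≤n
  l≤i+bilateral (suc l) zero    = ℕ.≤-trans (ℕ.m≤n*m (suc l) a {{>-nonZero 1≤a}}) (ℕ.m≤m+n (a * suc l) _)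
  l≤i+bilateral (suc l) (suc i) = s≤s (l≤i+bilateral l i)

  -- The sign is `(-1)^j` for `j = i - l`, since `l + i` has the same parity.
  term : ℕ → ℕ → Series
  term l i = sgn (l + i) ⊛ q^ bilateral l i

  term-diagonal : ∀ l i → term (suc l) (suc i) ≈ term l i
  term-diagonal l i rewrite ℕ.+-suc l i =
    solve 2 (λ x y → (:- (:- x)) :* y := x :* y) ≈-refl (sgn (l + i)) (q^ bilateral l i)
    where open S

  term-diagonal′ : ∀ l i → term l (l + i) ≈ term 0 i
  term-diagonal′ zero    i = ≈-refl
  term-diagonal′ (suc l) i = ≈-trans (term-diagonal l (l + i)) (term-diagonal′ l i)

  term-sucʳ : ∀ l i m d → m + l ≡ d + i → R^ d ⊛ term l (suc i) ≈ ⊝ q^ (s + r * m) ⊛ term l i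
  term-sucʳ l i m d eq rewrite ℕ.+-suc l i = begin
    R^ d ⊛ (⊝ σ ⊛ q^ bilateral l (suc i))
      ≈⟨ solve 3 (λ x y z → x :* ((:- y) :* z) := (:- y) :* (x :* z)) ≈-refl
                                               (R^ d) σ (q^ bilateral l (suc i)) ⟩
    ⊝ σ ⊛ (R^ d ⊛ q^ bilateral l (suc i))  ≈⟨ ⊛-congˡ (⊝ σ) (≈-trans (q^-+ (r * d) _)
                                               (≈-trans (q^-cong (sym (bilateral-sucʳ l i m d eq)))
                                                 (≈-sym (q^-+ (s + r * m) _)))) ⟩
    ⊝ σ ⊛ (q^ (s + r * m) ⊛ q^ bilateral l i)
      ≈⟨ solve 3 (λ x y z → (:- y) :* (x :* z) := (:- x) :* (y :* z)) ≈-refl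
                                               (q^ (s + r * m)) σ (q^ bilateral l i) ⟩
    ⊝ q^ (s + r * m) ⊛ (σ ⊛ q^ bilateral l i) ∎
    where
    σ = sgn (l + i)
    open S
    open ≈-Reasoning

  term-sucˡ : ∀ l i → R^ i ⊛ term (suc l) i ≈ ⊝ q^ (a + r * l) ⊛ term l i
  term-sucˡ l i = begin
    R^ i ⊛ (⊝ σ ⊛ q^ bilateral (suc l) i)
      ≈⟨ solve 3 (λ x y z → x :* ((:- y) :* z) := (:- y) :* (x :* z)) ≈-refl
                                               (R^ i) σ (q^ bilateral (suc l) i) ⟩
    ⊝ σ ⊛ (R^ i ⊛ q^ bilateral (suc l) i)  ≈⟨ ⊛-congˡ (⊝ σ) (≈-trans (q^-+ (r * i) _)
                                               (≈-trans (q^-cong (sym (bilateral-sucˡ l i)))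
                                                 (≈-sym (q^-+ (a + r * l) _)))) ⟩
    ⊝ σ ⊛ (q^ (a + r * l) ⊛ q^ bilateral l i)
      ≈⟨ solve 3 (λ x y z → (:- y) :* (x :* z) := (:- x) :* (y :* z)) ≈-refl
                                               (q^ (a + r * l)) σ (q^ bilateral l i) ⟩
    ⊝ q^ (a + r * l) ⊛ (σ ⊛ q^ bilateral l i) ∎
    where
    σ = sgn (l + i)
    open S
    open ≈-Reasoning

  -- Cauchy's finite version of the theta sum: for `n = m + l` the index `j = i - l` runs from `-l`
  -- to `m`.
  cauchySum : ℕ → ℕ → Series
  cauchySum l n = partialSum (λ i → term l i ⊛ gauss n i) 0 (suc n)

  Σ-boundary : ∀ (t : ℕ → Series) n →
               t 0 ⊛ 1ₛ ⊕ partialSum (λ i → t (suc i) ⊛ gauss n (suc i)) 0 (suc n) ≈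
               partialSum (λ i → t i ⊛ gauss n i) 0 (suc n)
  Σ-boundary t n = begin
    t 0 ⊛ 1ₛ ⊕ partialSum (λ i → t (suc i) ⊛ gauss n (suc i)) 0 (suc n)
      ≈⟨ Σ-front (λ i → t i ⊛ gauss n i) (suc n) ⟨
    X ⊕ t (suc n) ⊛ gauss n (suc n)
      ≈⟨ ⊕-cong (≈-refl {X}) (⊛-congˡ (t (suc n)) (gauss-< n (suc n) ℕ.≤-refl)) ⟩
    X ⊕ t (suc n) ⊛ 0ₛ
      ≈⟨ solve 2 (λ x y → x :+ y :* con 0ℤ := x) ≈-refl X (t (suc n)) ⟩
    X ∎
    where
    X = partialSum (λ i → t i ⊛ gauss n i) 0 (suc n)
    open S
    open ≈-Reasoning

  -- `gauss-pascal` puts the weight `R^ d` with `d = n - i` on term `i + 1`. This turns it into term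
  -- `i` times `- q^(s + r m)`, a multiplier that does not depend on `i`.
  cauchySum-sucʳ : ∀ m l → cauchySum l (suc (m + l)) ≈ cauchySum l (m + l) ⊛ qFactor s r m
  cauchySum-sucʳ m l = begin
    cauchySum l (suc n)
      ≈⟨ Σ-front (λ i → term l i ⊛ gauss (suc n) i) (suc n) ⟩
    term l 0 ⊛ 1ₛ ⊕ partialSum (λ i → term l (suc i) ⊛ gauss (suc n) (suc i)) 0 (suc n)
      ≈⟨ ⊕-cong (≈-refl {term l 0 ⊛ 1ₛ}) (Σ-cong (suc n) λ { i (s≤s i≤n) → split i (n ∸ i) (sym (ℕ.m+[n∸m]≡n i≤n)) }) ⟩
    term l 0 ⊛ 1ₛ ⊕ partialSum (λ i → u (suc i) ⊕ Q ⊛ u i) 0 (suc n)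
      ≈⟨ ⊕-cong (≈-refl {term l 0 ⊛ 1ₛ}) (≈-trans (Σ-⊕ (u ∘ suc) (λ i → Q ⊛ u i) (suc n))
           (⊕-cong (≈-refl {partialSum (u ∘ suc) 0 (suc n)}) (≈-sym (Σ-⊛ Q u (suc n))))) ⟩
    term l 0 ⊛ 1ₛ ⊕ (partialSum (u ∘ suc) 0 (suc n) ⊕ Q ⊛ cauchySum l n)
      ≈⟨ solve 3 (λ x y z → x :+ (y :+ z) := (x :+ y) :+ z) ≈-refl
           (term l 0 ⊛ 1ₛ) (partialSum (u ∘ suc) 0 (suc n)) (Q ⊛ cauchySum l n) ⟩
    (term l 0 ⊛ 1ₛ ⊕ partialSum (u ∘ suc) 0 (suc n)) ⊕ Q ⊛ cauchySum l n
      ≈⟨ ⊕-cong (Σ-boundary (term l) n) (≈-refl {Q ⊛ cauchySum l n}) ⟩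
    cauchySum l n ⊕ Q ⊛ cauchySum l n
      ≈⟨ solve 2 (λ x y → x :+ (:- y) :* x := x :* (con 1ℤ :- y)) ≈-refl (cauchySum l n) (q^ (s + r * m)) ⟩
    cauchySum l n ⊛ qFactor s r m ∎
    where
    n = m + l
    Q = ⊝ q^ (s + r * m)
    u : ℕ → Series
    u i = term l i ⊛ gauss n i
    open S
    open ≈-Reasoning
    split : ∀ i d → n ≡ i + d → term l (suc i) ⊛ gauss (suc n) (suc i) ≈ u (suc i) ⊕ Q ⊛ u i
    split i d eq = begin
      term l (suc i) ⊛ gauss (suc n) (suc i)
        ≈⟨ ⊛-congˡ (term l (suc i)) (subst (λ m → gauss (suc m) (suc i) ≈ gauss m (suc i) ⊕ R^ d ⊛ gauss m i)
             (sym eq) (gauss-pascal i d)) ⟩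
      term l (suc i) ⊛ (gauss n (suc i) ⊕ R^ d ⊛ gauss n i)
        ≈⟨ solve 4 (λ t g x h → t :* (g :+ x :* h) := t :* g :+ (x :* t) :* h) ≈-refl
             (term l (suc i)) (gauss n (suc i)) (R^ d) (gauss n i) ⟩
      u (suc i) ⊕ (R^ d ⊛ term l (suc i)) ⊛ gauss n i
        ≈⟨ ⊕-cong (≈-refl {u (suc i)}) (≈-trans
             (⊛-congʳ (gauss n i) (term-sucʳ l i m d (trans eq (ℕ.+-comm i d))))
             (⊛-assoc Q (term l i) (gauss n i))) ⟩
      u (suc i) ⊕ Q ⊛ u i ∎

  -- Here the defining Pascal rule fits: its weight `R^ i` turns term `i` for `l + 1` into term `i`
  -- for `l`, times the constant `- q^(a + r l)`.
  cauchySum-sucˡ : ∀ n l → cauchySum (suc l) (suc n) ≈ cauchySum l n ⊛ qFactor a r l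
  cauchySum-sucˡ n l = begin
    cauchySum (suc l) (suc n)
      ≈⟨ Σ-front (λ i → term (suc l) i ⊛ gauss (suc n) i) (suc n) ⟩
    term (suc l) 0 ⊛ 1ₛ ⊕ partialSum (λ i → term (suc l) (suc i) ⊛ gauss (suc n) (suc i)) 0 (suc n)
      -- The factor `R^ 0`, which is 1, is inserted so that the first summand fits the pattern of
      -- `v`.
      ≈⟨ ⊕-cong (≈-trans (≈-sym (⊛-identityˡ (term (suc l) 0 ⊛ 1ₛ)))
           (≈-trans (≈-sym (⊛-assoc 1ₛ (term (suc l) 0) 1ₛ))
             (⊛-congʳ 1ₛ (⊛-congʳ (term (suc l) 0) (q^-cong (sym (ℕ.*-zeroʳ r)))))))
         (Σ-cong (suc n) λ i _ → split i) ⟩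
    v 0 ⊛ 1ₛ ⊕ partialSum (λ i → u i ⊕ v (suc i) ⊛ gauss n (suc i)) 0 (suc n)
      ≈⟨ ⊕-cong (≈-refl {v 0 ⊛ 1ₛ}) (Σ-⊕ u (λ i → v (suc i) ⊛ gauss n (suc i)) (suc n)) ⟩
    v 0 ⊛ 1ₛ ⊕ (cauchySum l n ⊕ partialSum (λ i → v (suc i) ⊛ gauss n (suc i)) 0 (suc n))
      ≈⟨ solve 3 (λ x y z → x :+ (y :+ z) := y :+ (x :+ z)) ≈-refl (v 0 ⊛ 1ₛ) (cauchySum l n)
           (partialSum (λ i → v (suc i) ⊛ gauss n (suc i)) 0 (suc n)) ⟩
    cauchySum l n ⊕ (v 0 ⊛ 1ₛ ⊕ partialSum (λ i → v (suc i) ⊛ gauss n (suc i)) 0 (suc n))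
      ≈⟨ ⊕-cong (≈-refl {cauchySum l n}) (≈-trans (Σ-boundary v n)
           (≈-trans (Σ-cong (suc n) λ i _ → ≈-trans (⊛-congʳ (gauss n i) (term-sucˡ l i)) (⊛-assoc Q (term l i) (gauss n i)))
             (≈-sym (Σ-⊛ Q u (suc n))))) ⟩
    cauchySum l n ⊕ Q ⊛ cauchySum l n
      ≈⟨ solve 2 (λ x y → x :+ (:- y) :* x := x :* (con 1ℤ :- y)) ≈-refl (cauchySum l n) (q^ (a + r * l)) ⟩
    cauchySum l n ⊛ qFactor a r l ∎
    where
    Q = ⊝ q^ (a + r * l)
    u v : ℕ → Series
    u i = term l i ⊛ gauss n i
    v i = R^ i ⊛ term (suc l) i
    open S
    open ≈-Reasoning
    split : ∀ i → term (suc l) (suc i) ⊛ gauss (suc n) (suc i) ≈ u i ⊕ v (suc i) ⊛ gauss n (suc i)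
    split i = begin
      term (suc l) (suc i) ⊛ gauss (suc n) (suc i)
        ≈⟨ solve 4 (λ t g x h → t :* (g :+ x :* h) := t :* g :+ (x :* t) :* h) ≈-refl
             (term (suc l) (suc i)) (gauss n i) (R^ suc i) (gauss n (suc i)) ⟩
      term (suc l) (suc i) ⊛ gauss n i ⊕ v (suc i) ⊛ gauss n (suc i)
        ≈⟨ ⊕-cong (⊛-congʳ (gauss n i) (term-diagonal l i)) (≈-refl {v (suc i) ⊛ gauss n (suc i)}) ⟩
      u i ⊕ v (suc i) ⊛ gauss n (suc i) ∎

  finite-triple-product : ∀ m l → partialProduct (qFactor s r) m ⊛ partialProduct (qFactor a r) l ≈
                                  cauchySum l (m + l)
  finite-triple-product zero zero = begin
    1ₛ ⊛ 1ₛ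
      ≈⟨ ⊛-congʳ 1ₛ (q^-cong (sym (cong₂ _+_ (ℕ.*-zeroʳ s) (ℕ.*-zeroʳ r)))) ⟩
    q^ bilateral 0 0 ⊛ 1ₛ
      ≈⟨ solve 1 (λ x → x :* con 1ℤ := con 0ℤ :+ con 1ℤ :* x :* con 1ℤ) ≈-refl (q^ bilateral 0 0) ⟩
    cauchySum 0 0                ∎
    where
    open S
    open ≈-Reasoning
  finite-triple-product zero (suc l) = begin
    1ₛ ⊛ (P ⊛ qFactor a r l)  ≈⟨ ⊛-assoc 1ₛ P (qFactor a r l) ⟨
    1ₛ ⊛ P ⊛ qFactor a r l    ≈⟨ ⊛-congʳ (qFactor a r l) (finite-triple-product zero l) ⟩
    cauchySum l l ⊛ qFactor a r l  ≈⟨ cauchySum-sucˡ l l ⟨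
    cauchySum (suc l) (suc l) ∎
    where
    P = partialProduct (qFactor a r) l
    open ≈-Reasoning
  finite-triple-product (suc m) l = begin
    P ⊛ qFactor s r m ⊛ P′
      ≈⟨ solve 3 (λ x y z → x :* y :* z := x :* z :* y) ≈-refl P (qFactor s r m) P′ ⟩
    P ⊛ P′ ⊛ qFactor s r m  ≈⟨ ⊛-congʳ (qFactor s r m) (finite-triple-product m l) ⟩
    cauchySum l (m + l) ⊛ qFactor s r m  ≈⟨ cauchySum-sucʳ m l ⟨
    cauchySum l (suc (m + l)) ∎
    where
    P  = partialProduct (qFactor s r) m
    P′ = partialProduct (qFactor a r) l
    open S
    open ≈-Reasoning

  E : Series
  E = qPochhammer r r

  -- If the exponent of the term is at least `K`, both sides vanish. Otherwise `i` is within `K` of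
  -- `n`, so `2 K ≤ n` leaves room on both sides of `i` for `E⊛gauss-mod`.
  E⊛term-mod : ∀ {K} n i → K + K ≤ n → i ≤ suc (n + n) →
               E ⊛ (term n i ⊛ gauss (suc (n + n)) i) ≈ term n i mod-q^ K
  E⊛term-mod {K} n i 2K≤n i≤2n+1 with K ℕ.≤? bilateral n i
  ... | yes K≤b = mod-trans
    (≈⇒mod (solve 4 (λ e σ x g → e :* (σ :* x :* g) := x :* (e :* σ :* g)) ≈-refl
      E (sgn (n + i)) (q^ bilateral n i) (gauss (suc (n + n)) i)))
    (mod-trans (q^-mod-0 (bilateral n i) (E ⊛ sgn (n + i) ⊛ gauss (suc (n + n)) i) K≤b)
    (mod-sym (mod-trans (≈⇒mod (⊛-comm (sgn (n + i)) (q^ bilateral n i)))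
                        (q^-mod-0 (bilateral n i) (sgn (n + i)) K≤b))))
    where open S
  ... | no K≰b = mod-trans
    (≈⇒mod (solve 3 (λ e t g → e :* (t :* g) := t :* (e :* g)) ≈-refl E (term n i) (gauss (suc (n + n)) i)))
    (mod-trans (⊛-modˡ (term n i) (subst (λ m → E ⊛ gauss m i ≈ 1ₛ mod-q^ K) (ℕ.m+[n∸m]≡n i≤2n+1)
      (E⊛gauss-mod 1≤r i (suc (n + n) ∸ i) K≤i K≤1+d)))
    (≈⇒mod (pointwise (⊛-identityʳ (term n i)))))
    where
    open S
    b<K : bilateral n i ≤ K
    b<K = ℕ.<⇒≤ (ℕ.≰⇒> K≰b)
    K≤i : K ≤ i
    K≤i = ℕ.+-cancelʳ-≤ K K i (ℕ.≤-trans 2K≤n (ℕ.≤-trans (l≤i+bilateral n i) (ℕ.+-monoʳ-≤ i b<K)))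
    K≤1+d : K ≤ suc (suc (n + n) ∸ i)
    K≤1+d = ℕ.m≤n⇒m≤1+n (ℕ.m+n≤o⇒m≤o∸n K (ℕ.≤-trans (ℕ.+-monoʳ-≤ K (ℕ.≤-trans (i≤l+bilateral n i) (ℕ.+-monoʳ-≤ n b<K)))
      (ℕ.≤-trans (ℕ.≤-reflexive (solveℕ K n)) (ℕ.≤-trans (ℕ.+-monoʳ-≤ n 2K≤n) (ℕ.n≤1+n (n + n))))))
      where
      solveℕ : ∀ K n → K + (n + K) ≡ n + (K + K)
      solveℕ = ℕS.solve 2 (λ K n → K ℕS.:+ (n ℕS.:+ K) ℕS.:= n ℕS.:+ (K ℕS.:+ K)) refl
        where module ℕS = ℕ-Solver

  2*tri : ∀ j → tri (suc j) * 2 ≡ j * (j + 1)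
  2*tri zero    = refl
  2*tri (suc j) = trans (ℕ.*-distribʳ-+ 2 (tri (suc j)) (suc j)) (trans (cong (_+ suc j * 2) (2*tri j))
    (solve 1 (λ j → j :* (j :+ con 1) :+ (con 1 :+ j) :* con 2 := (con 1 :+ j) :* (con 1 :+ j :+ con 1)) refl j))
    where open ℕ-Solver

  exponent-tri : ∀ j → exponent r j ≡ r * tri (suc j)
  exponent-tri j = trans (ℕ./-congˡ (trans (cong (r *_) (sym (2*tri j))) (sym (ℕ.*-assoc r (tri (suc j)) 2))))
    (ℕ.m*n/n≡m (r * tri (suc j)) 2)

  -- The two powers of `q` belong to the bilateral indices `-j` and `j + 1`.
  thetaTerm-term : ∀ j → thetaTerm r s j ≈ term j 0 ⊕ term 0 (suc j)
  thetaTerm-term j = begin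
    (-1ℤ ℤ.^ j) · (q^ (exponent r j ∸ s * j) ⊖ q^ (exponent r j + (j + 1) * s))
      ≈⟨ const-⊛ (-1ℤ ℤ.^ j) (q^ (exponent r j ∸ s * j) ⊖ q^ (exponent r j + (j + 1) * s)) ⟨
    const (-1ℤ ℤ.^ j) ⊛ (q^ (exponent r j ∸ s * j) ⊖ q^ (exponent r j + (j + 1) * s))
      ≈⟨ ⊛-cong (-1^-sgn j) (⊖-cong (q^-cong e₁) (q^-cong e₂)) ⟩
    sgn j ⊛ (q^ bilateral j 0 ⊖ q^ bilateral 0 (suc j))
      ≈⟨ solve 3 (λ σ x y → σ :* (x :- y) := σ :* x :+ (:- σ) :* y) ≈-refl (sgn j) (q^ bilateral j 0) (q^ bilateral 0 (suc j)) ⟩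
    sgn j ⊛ q^ bilateral j 0 ⊕ term 0 (suc j)
      ≈⟨ ⊕-cong (⊛-congʳ (q^ bilateral j 0) (≡⇒≈ (cong sgn (sym (ℕ.+-identityʳ j))))) (≈-refl {term 0 (suc j)}) ⟩
    term j 0 ⊕ term 0 (suc j) ∎
    where
    open S
    open ≈-Reasoning
    e₁ : exponent r j ∸ s * j ≡ bilateral j 0
    e₁ rewrite exponent-tri j | bilateral-0 j = trans
      (cong (_∸ s * j) (ℕS.solve 4 (λ s a j t → (s ℕS.:+ a) ℕS.:* (t ℕS.:+ j) ℕS.:=
          a ℕS.:* j ℕS.:+ (s ℕS.:+ a) ℕS.:* t ℕS.:+ s ℕS.:* j) refl s a j (tri j)))
      (ℕ.m+n∸n≡m (a * j + r * tri j) (s * j))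
      where module ℕS = ℕ-Solver
    e₂ : exponent r j + (j + 1) * s ≡ bilateral 0 (suc j)
    e₂ rewrite exponent-tri j = ℕS.solve 4 (λ r s j t → r ℕS.:* (t ℕS.:+ j) ℕS.:+ (j ℕS.:+ ℕS.con 1) ℕS.:* s ℕS.:=
          s ℕS.:* (ℕS.con 1 ℕS.:+ j) ℕS.:+ r ℕS.:* (t ℕS.:+ j)) refl r s j (tri j)
      where module ℕS = ℕ-Solver

  -- The pairs `-j`, `j + 1` with `j ≤ n` fill the range from `-n` to `n + 1`. This asymmetry is why
  -- the finite product is later taken with `n + 1` factors in `s` and `n` in `a`.
  Σ-bilateral : ∀ n → partialSum (term n) 0 (suc (suc (n + n))) ≈ partialSum (thetaTerm r s) 0 (suc n)
  Σ-bilateral zero = begin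
    0ₛ ⊕ term 0 0 ⊕ term 0 1
      ≈⟨ solve 2 (λ x y → con 0ℤ :+ x :+ y := con 0ℤ :+ (x :+ y)) ≈-refl (term 0 0) (term 0 1) ⟩
    0ₛ ⊕ (term 0 0 ⊕ term 0 1)  ≈⟨ ⊕-cong (≈-refl {0ₛ}) (thetaTerm-term 0) ⟨
    0ₛ ⊕ thetaTerm r s 0        ∎
    where
    open S
    open ≈-Reasoning
  Σ-bilateral (suc n) = begin
    partialSum (term (suc n)) 0 (suc (suc (suc (n + suc n))))
      ≈⟨ ≡⇒≈ (cong (λ m → partialSum (term (suc n)) 0 (suc (suc (suc m)))) (ℕ.+-suc n n)) ⟩
    partialSum (term (suc n)) 0 (suc (suc (suc (suc (n + n)))))
      ≈⟨ Σ-front (term (suc n)) (suc (suc (suc (n + n)))) ⟩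
    term (suc n) 0 ⊕ partialSum (term (suc n) ∘ suc) 0 (suc (suc (suc (n + n))))
      ≈⟨ ⊕-cong (≈-refl {term (suc n) 0}) (Σ-cong (suc (suc (suc (n + n)))) λ i _ → term-diagonal n i) ⟩
    term (suc n) 0 ⊕ (partialSum (term n) 0 (suc (suc (n + n))) ⊕ term n (suc (suc (n + n))))
      ≈⟨ ⊕-cong (≈-refl {term (suc n) 0}) (⊕-cong (Σ-bilateral n)
           (≈-trans (≡⇒≈ (cong (term n) (sym (trans (ℕ.+-suc n (suc n)) (cong suc (ℕ.+-suc n n))))))
                    (term-diagonal′ n (suc (suc n))))) ⟩
    term (suc n) 0 ⊕ (X ⊕ term 0 (suc (suc n)))
      ≈⟨ solve 3 (λ x y z → x :+ (y :+ z) := y :+ (x :+ z)) ≈-refl (term (suc n) 0) X (term 0 (suc (suc n))) ⟩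
    X ⊕ (term (suc n) 0 ⊕ term 0 (suc (suc n)))
      ≈⟨ ⊕-cong (≈-refl {X}) (thetaTerm-term (suc n)) ⟨
    X ⊕ thetaTerm r s (suc n) ∎
    where
    X = partialSum (thetaTerm r s) 0 (suc n)
    open S
    open ≈-Reasoning

  triple-product : 2 * s < r → sumFrom 0 (thetaTerm r s) ≈ qPochhammer s r ⊛ qPochhammer a r ⊛ E
  triple-product 2s<r = mod⇒≈ λ K → let n = K + K in
    mod-trans (below λ m m<K → sym (proj₂ (⟶-theta r s 0 2s<r m) (suc n)
      (ℕ.m≤n⇒m≤1+n (ℕ.≤-trans m<K (ℕ.m≤m+n K K)))))
    (mod-trans (≈⇒mod (≈-sym (Σ-bilateral n)))
    (mod-trans (Σ-mod (suc (suc (n + n))) λ { i (s≤s i≤) → mod-sym (E⊛term-mod n i ℕ.≤-refl i≤) })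
    (mod-trans (≈⇒mod (≈-sym (Σ-⊛ E (λ i → term n i ⊛ gauss (suc (n + n)) i) (suc (suc (n + n))))))
    (mod-trans (⊛-modˡ E (≈⇒mod (≈-sym (finite-triple-product (suc n) n))))
    (mod-trans (⊛-modˡ E (⊛-mod
      (qPochhammer-mod s r (suc n) 1≤s 1≤r (ℕ.m≤n⇒m≤1+n (ℕ.m≤m+n K K)))
      (qPochhammer-mod a r n 1≤a 1≤r (ℕ.m≤m+n K K))))
    (≈⇒mod (⊛-comm E (qPochhammer s r ⊛ qPochhammer a r))))))))

jacobi-triple-product : ∀ r s → 1 ≤ s → 2 * s < r →
                        sumFrom 0 (thetaTerm r s) ≈ denominator r s ⊛ qPochhammer r r
jacobi-triple-product r s 1≤s 2s<r = subst
  (λ x → 2 * s < x → sumFrom 0 (thetaTerm x s) ≈ qPochhammer s x ⊛ qPochhammer (r ∸ s) x ⊛ qPochhammer x x)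
  (ℕ.m+[n∸m]≡n (ℕ.<⇒≤ s<r))
  (TripleProduct.triple-product s (r ∸ s) 1≤s (ℕ.m<n⇒0<n∸m s<r)) 2s<r
  where
  s<r : s < r
  s<r = ℕ.≤-<-trans (ℕ.m≤n*m s 2) 2s<r

-- Coefficientwise order

infix 4 _≼_

record _≼_ (f g : Series) : Set where
  constructor pointwise≤
  field at≤ : ∀ n → f n ℤ.≤ g n

open _≼_

≼-trans : ∀ {f g h} → f ≼ g → g ≼ h → f ≼ h
≼-trans p r .at≤ n = ℤ.≤-trans (p .at≤ n) (r .at≤ n)

≈⇒≼ : ∀ {f g} → f ≈ g → f ≼ g
≈⇒≼ p .at≤ n = ℤ.≤-reflexive (p .at n)

≈⇒≽ : ∀ {f g} → f ≈ g → g ≼ f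
≈⇒≽ p .at≤ n = ℤ.≤-reflexive (sym (p .at n))

⊕-mono : ∀ {f f′ g g′} → f ≼ f′ → g ≼ g′ → f ⊕ g ≼ f′ ⊕ g′
⊕-mono p r .at≤ n = ℤ.+-mono-≤ (p .at≤ n) (r .at≤ n)

*-monoʳ : ∀ {i j k} → 0ℤ ℤ.≤ k → i ℤ.≤ j → i ℤ.* k ℤ.≤ j ℤ.* k
*-monoʳ {k = k} 0≤k i≤j = ℤ.*-monoʳ-≤-nonNeg k {{ℤ.nonNegative 0≤k}} i≤j

*-monoˡ : ∀ {i j k} → 0ℤ ℤ.≤ k → i ℤ.≤ j → k ℤ.* i ℤ.≤ k ℤ.* j
*-monoˡ {k = k} 0≤k i≤j = ℤ.*-monoˡ-≤-nonNeg k {{ℤ.nonNegative 0≤k}} i≤j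

0≤+ : ∀ n → 0ℤ ℤ.≤ ℤ.+ n
0≤+ n = ℤ.+≤+ z≤n

⊛-monoˡ-≼ : ∀ {f g} p → 0ₛ ≼ p → f ≼ g → f ⊛ p ≼ g ⊛ p
⊛-monoˡ-≼ p 0≼p f≼g .at≤ zero    = ℤ.+-mono-≤ (*-monoʳ (0≼p .at≤ 0) (f≼g .at≤ 0)) ℤ.≤-refl
⊛-monoˡ-≼ {f} {g} p 0≼p f≼g .at≤ (suc n) = ℤ.+-mono-≤ (*-monoʳ (0≼p .at≤ (suc n)) (f≼g .at≤ 0))
  (⊛-monoˡ-≼ {f ∘ suc} {g ∘ suc} p 0≼p (pointwise≤ λ i → f≼g .at≤ (suc i)) .at≤ n)

0ₛ⊛ : ∀ f → 0ₛ ⊛ f ≈ 0ₛ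
0ₛ⊛ = solve 1 (λ f → con 0ℤ :* f := con 0ℤ) ≈-refl
  where open S

⊛-nonneg : ∀ {f g} → 0ₛ ≼ f → 0ₛ ≼ g → 0ₛ ≼ f ⊛ g
⊛-nonneg {f} {g} 0≼f 0≼g = ≼-trans (≈⇒≽ (0ₛ⊛ g)) (⊛-monoˡ-≼ g 0≼g 0≼f)

0≼q^ : ∀ e → 0ₛ ≼ q^ e
0≼q^ zero    .at≤ zero    = ℤ.+≤+ z≤n
0≼q^ zero    .at≤ (suc n) = ℤ.≤-refl
0≼q^ (suc e) .at≤ zero    = ℤ.≤-refl
0≼q^ (suc e) .at≤ (suc n) = 0≼q^ e .at≤ n

q^-e : ∀ e → (q^ e) e ≡ 1ℤ
q^-e zero    = refl
q^-e (suc e) = q^-e e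

q^-≢ : ∀ e n → e ≢ n → (q^ e) n ≡ 0ℤ
q^-≢ e n e≢n rewrite dec-false (e ℕ.≟ n) e≢n = refl

-- The operator q d/dq

θ : Series → Series
θ f n = ℤ.+ n ℤ.* f n

θ-cong : ∀ {f g} → f ≈ g → θ f ≈ θ g
θ-cong p .at n = cong (ℤ.+ n ℤ.*_) (p .at n)

θ-⊛ : ∀ f g → θ (f ⊛ g) ≈ θ f ⊛ g ⊕ f ⊛ θ g
θ-⊛ f g .at zero = solve 2 (λ x y → con 0ℤ :* (x :* y :+ con 0ℤ) :=
                      (con 0ℤ :* x :* y :+ con 0ℤ) :+ (x :* (con 0ℤ :* y) :+ con 0ℤ)) refl (f 0) (g 0)
  where open +-*-Solver
θ-⊛ f g .at (suc n) = begin
  (1ℤ ℤ.+ ν) ℤ.* (f 0 ℤ.* g (suc n) ℤ.+ c)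
    ≡⟨ solve 4 (λ ν x y c → (con 1ℤ :+ ν) :* (x :* y :+ c)
                         := (con 1ℤ :+ ν) :* (x :* y) :+ (c :+ ν :* c)) refl ν (f 0) (g (suc n)) c ⟩
  (1ℤ ℤ.+ ν) ℤ.* (f 0 ℤ.* g (suc n)) ℤ.+ (c ℤ.+ ν ℤ.* c)
    ≡⟨ cong (λ x → (1ℤ ℤ.+ ν) ℤ.* (f 0 ℤ.* g (suc n)) ℤ.+ (c ℤ.+ x)) (θ-⊛ f′ g .at n) ⟩
  (1ℤ ℤ.+ ν) ℤ.* (f 0 ℤ.* g (suc n)) ℤ.+ (c ℤ.+ ((θ f′ ⊛ g) n ℤ.+ (f′ ⊛ θ g) n))
    ≡⟨ solve 6 (λ ν x y c u w → (con 1ℤ :+ ν) :* (x :* y) :+ (c :+ (u :+ w))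
         := (con 0ℤ :* x :* y :+ (u :+ c)) :+ (x :* ((con 1ℤ :+ ν) :* y) :+ w)) refl
         ν (f 0) (g (suc n)) c ((θ f′ ⊛ g) n) ((f′ ⊛ θ g) n) ⟩
  (0ℤ ℤ.* f 0 ℤ.* g (suc n) ℤ.+ ((θ f′ ⊛ g) n ℤ.+ c)) ℤ.+ (f ⊛ θ g) (suc n)
    ≡⟨ cong (λ x → (0ℤ ℤ.* f 0 ℤ.* g (suc n) ℤ.+ x) ℤ.+ (f ⊛ θ g) (suc n)) (tail .at n) ⟨
  (θ f ⊛ g) (suc n) ℤ.+ (f ⊛ θ g) (suc n) ∎
  where
  open +-*-Solver
  open ≡-Reasoning
  ν = ℤ.+ n
  f′ = f ∘ suc
  c = (f′ ⊛ g) n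
  tail : (θ f ∘ suc) ⊛ g ≈ θ f′ ⊛ g ⊕ f′ ⊛ g
  tail = ≈-trans (⊛-congʳ g {θ f ∘ suc} {θ f′ ⊕ f′} (pointwise λ i →
           solve 2 (λ i x → (con 1ℤ :+ i) :* x := i :* x :+ x) refl (ℤ.+ i) (f′ i)))
         (⊛-distribʳ (θ f′) f′ g)

θ-q^ : ∀ e → θ (q^ e) ≈ const (ℤ.+ e) ⊛ q^ e
θ-q^ e = ≈-trans (pointwise eq) (≈-sym (const-⊛ (ℤ.+ e) (q^ e)))
  where
  eq : ∀ n → ℤ.+ n ℤ.* (q^ e) n ≡ ℤ.+ e ℤ.* (q^ e) n
  eq n with e ℕ.≟ n
  ... | yes refl = refl
  ... | no  e≢n rewrite q^-≢ e n e≢n = trans (ℤ.*-zeroʳ (ℤ.+ n)) (sym (ℤ.*-zeroʳ (ℤ.+ e)))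

-- The geometric series 1 / (1 - q^d)

geom : ℕ → Series
geom d = inv (1−q^ d)

geom-inverse : ∀ d → 1 ≤ d → geom d ⊛ 1−q^ d ≈ 1ₛ
geom-inverse d 1≤d = inv-inverseˡ (1−q^ d) (1−q^-0 d 1≤d)

geom-step : ∀ d → 1 ≤ d → geom d ≈ 1ₛ ⊕ q^ d ⊛ geom d
geom-step d 1≤d = begin
  geom d
    ≈⟨ solve 2 (λ g x → g := g :* (con 1ℤ :- x) :+ x :* g) ≈-refl (geom d) (q^ d) ⟩
  geom d ⊛ 1−q^ d ⊕ q^ d ⊛ geom d       ≈⟨ ⊕-cong (geom-inverse d 1≤d) (≈-refl {q^ d ⊛ geom d}) ⟩
  1ₛ ⊕ q^ d ⊛ geom d                    ∎
  where
  open S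
  open ≈-Reasoning

geom-< : ∀ d → 1 ≤ d → ∀ n → suc n < d → geom d (suc n) ≡ 0ℤ
geom-< d 1≤d n n<d = trans (geom-step d 1≤d .at (suc n)) (trans (ℤ.+-identityˡ _) (q^-⊛-< d (geom d) (suc n) n<d))

geom-≥ : ∀ d → 1 ≤ d → ∀ n → d ≤ suc n → geom d (suc n) ≡ geom d (suc n ∸ d)
geom-≥ d 1≤d n d≤n = trans (geom-step d 1≤d .at (suc n)) (trans (ℤ.+-identityˡ _)
  (trans (cong (q^ d ⊛ geom d) (sym (ℕ.m+[n∸m]≡n d≤n))) (q^-⊛-+ d (geom d) (suc n ∸ d))))

geom-bounds : ∀ d → 1 ≤ d → ∀ n → 0ℤ ℤ.≤ geom d n × geom d n ℤ.≤ 1ℤ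
geom-bounds d 1≤d n = go (suc n) n ℕ.≤-refl
  where
  InUnit : ℤ → Set
  InUnit x = 0ℤ ℤ.≤ x × x ℤ.≤ 1ℤ
  -- `m` is fuel for the recursion, in which the index drops by `d`.
  go : ∀ m n → n < m → InUnit (geom d n)
  go (suc m) zero    _           = ℤ.+≤+ z≤n , ℤ.≤-refl
  go (suc m) (suc n) (s≤s n<m) with d ℕ.≤? suc n
  ... | no  d≰n = subst InUnit (sym (geom-< d 1≤d n (ℕ.≰⇒> d≰n))) (ℤ.≤-refl , ℤ.+≤+ z≤n)
  ... | yes d≤n = subst InUnit (sym (geom-≥ d 1≤d n d≤n))
                    (go m (suc n ∸ d) (ℕ.<-≤-trans (ℕ.∸-monoʳ-< 1≤d d≤n) n<m))

0≼geom : ∀ d → 1 ≤ d → 0ₛ ≼ geom d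
0≼geom d 1≤d .at≤ n = proj₁ (geom-bounds d 1≤d n)

-- The logarithmic derivative of geom d is divisorTerm d, whose coefficient of q^m is d if d
-- divides m ≥ 1 and 0 otherwise.
divisorTerm : ℕ → Series
divisorTerm d = const (ℤ.+ d) ⊛ (q^ d ⊛ geom d)

-- Applying `θ` to `g = 1 + q^d g` gives `(1 - q^d) θ g = d q^d g`; then multiply by `g`.
θ-geom : ∀ d → 1 ≤ d → θ (geom d) ≈ divisorTerm d ⊛ geom d
θ-geom d 1≤d = begin
  θ g                                   ≈⟨ ⊛-identityˡ (θ g) ⟨
  1ₛ ⊛ θ g                              ≈⟨ ⊛-congʳ (θ g) (geom-inverse d 1≤d) ⟨
  g ⊛ 1−q^ d ⊛ θ g
    ≈⟨ solve 3 (λ g x t → g :* (con 1ℤ :- x) :* t := g :* (t :- x :* t)) ≈-refl g (q^ d) (θ g) ⟩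
  g ⊛ (θ g ⊖ q^ d ⊛ θ g)                ≈⟨ ⊛-congˡ g (⊖-cong θg-step (≈-refl {q^ d ⊛ θ g})) ⟩
  g ⊛ (D ⊛ q^ d ⊛ g ⊕ q^ d ⊛ θ g ⊖ q^ d ⊛ θ g)
    ≈⟨ solve 4 (λ g D x t → g :* (D :* x :* g :+ x :* t :- x :* t) := D :* (x :* g) :* g)
                                              ≈-refl g D (q^ d) (θ g) ⟩
  divisorTerm d ⊛ g                     ∎
  where
  open S
  open ≈-Reasoning
  g = geom d
  D = const (ℤ.+ d)
  θg-step : θ g ≈ D ⊛ q^ d ⊛ g ⊕ q^ d ⊛ θ g
  θg-step = begin
    θ g                                     ≈⟨ θ-cong (geom-step d 1≤d) ⟩
    θ (1ₛ ⊕ q^ d ⊛ g)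
      ≈⟨ pointwise (λ n → ℤ.*-distribˡ-+ (ℤ.+ n) (1ₛ n) ((q^ d ⊛ g) n)) ⟩
    θ 1ₛ ⊕ θ (q^ d ⊛ g)
      ≈⟨ ⊕-cong (≈-trans (θ-q^ 0) (0ₛ⊛ 1ₛ)) (≈-trans (θ-⊛ (q^ d) g)
                                                 (⊕-cong (⊛-congʳ g (θ-q^ d)) (≈-refl {q^ d ⊛ θ g}))) ⟩
    0ₛ ⊕ (D ⊛ q^ d ⊛ g ⊕ q^ d ⊛ θ g)
      ≈⟨ solve 1 (λ x → con 0ℤ :+ x := x) ≈-refl (D ⊛ q^ d ⊛ g ⊕ q^ d ⊛ θ g) ⟩
    D ⊛ q^ d ⊛ g ⊕ q^ d ⊛ θ g               ∎

divisorTerm-at : ∀ d m → divisorTerm d m ≡ ℤ.+ d ℤ.* (q^ d ⊛ geom d) m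
divisorTerm-at d m = const-⊛ (ℤ.+ d) (q^ d ⊛ geom d) .at m

divisorTerm-< : ∀ d m → m < d → divisorTerm d m ≡ 0ℤ
divisorTerm-< d m m<d = trans (divisorTerm-at d m)
  (trans (cong (ℤ.+ d ℤ.*_) (q^-⊛-< d (geom d) m m<d)) (ℤ.*-zeroʳ (ℤ.+ d)))

divisorTerm-≤ : ∀ d → 1 ≤ d → ∀ m → divisorTerm d m ℤ.≤ ℤ.+ m
divisorTerm-≤ d 1≤d m with d ℕ.≤? m
... | no  d≰m = ℤ.≤-trans (ℤ.≤-reflexive (divisorTerm-< d m (ℕ.≰⇒> d≰m))) (0≤+ m)
... | yes d≤m = begin
  divisorTerm d m                    ≡⟨ divisorTerm-at d m ⟩
  ℤ.+ d ℤ.* (q^ d ⊛ geom d) m        ≡⟨ cong (λ k → ℤ.+ d ℤ.* (q^ d ⊛ geom d) k) (ℕ.m+[n∸m]≡n d≤m) ⟨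
  ℤ.+ d ℤ.* (q^ d ⊛ geom d) (d + (m ∸ d)) ≡⟨ cong (ℤ.+ d ℤ.*_) (q^-⊛-+ d (geom d) (m ∸ d)) ⟩
  ℤ.+ d ℤ.* geom d (m ∸ d)           ≤⟨ *-monoˡ (0≤+ d) (proj₂ (geom-bounds d 1≤d (m ∸ d))) ⟩
  ℤ.+ d ℤ.* 1ℤ                       ≡⟨ ℤ.*-identityʳ (ℤ.+ d) ⟩
  ℤ.+ d                              ≤⟨ ℤ.+≤+ d≤m ⟩
  ℤ.+ m                              ∎
  where open ℤ.≤-Reasoning

-- Slow growth of the reciprocal products

sq : Series
sq n = ℤ.+ (n * n)

module _ (x r : ℕ) (1≤x : 1 ≤ x) (1≤r : 1 ≤ r) where

  part : ℕ → ℕ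
  part i = x + r * i

  1≤part : ∀ i → 1 ≤ part i
  1≤part i = ℕ.≤-trans 1≤x (ℕ.m≤m+n x (r * i))

  geomProduct : ℕ → Series
  geomProduct = partialProduct (geom ∘ part)

  divisorSum : ℕ → Series
  divisorSum = partialSum (divisorTerm ∘ part) 0

  0≼geomProduct : ∀ n → 0ₛ ≼ geomProduct n
  0≼geomProduct zero    = 0≼q^ 0
  0≼geomProduct (suc n) = ⊛-nonneg (0≼geomProduct n) (0≼geom (part n) (1≤part n))

  θ-geomProduct : ∀ n → θ (geomProduct n) ≈ divisorSum n ⊛ geomProduct n
  θ-geomProduct zero    = ≈-trans (θ-q^ 0) (≈-trans (0ₛ⊛ 1ₛ) (≈-sym (0ₛ⊛ 1ₛ)))
  θ-geomProduct (suc n) = begin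
    θ (p ⊛ g)                    ≈⟨ θ-⊛ p g ⟩
    θ p ⊛ g ⊕ p ⊛ θ g
      ≈⟨ ⊕-cong (⊛-congʳ g (θ-geomProduct n)) (⊛-congˡ p (θ-geom (part n) (1≤part n))) ⟩
    divisorSum n ⊛ p ⊛ g ⊕ p ⊛ (τ ⊛ g)
      ≈⟨ solve 4 (λ σ p g t → σ :* p :* g :+ p :* (t :* g) := (σ :+ t) :* (p :* g))
                                       ≈-refl (divisorSum n) p g τ ⟩
    (divisorSum n ⊕ τ) ⊛ (p ⊛ g) ∎
    where
    open S
    open ≈-Reasoning
    p = geomProduct n
    g = geom (part n)
    τ = divisorTerm (part n)

  divisorSum-≤ : ∀ n m → divisorSum n m ℤ.≤ ℤ.+ (n * m)
  divisorSum-≤ zero    m = ℤ.≤-refl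
  divisorSum-≤ (suc n) m = begin
    divisorSum n m ℤ.+ divisorTerm (part n) m
      ≤⟨ ℤ.+-mono-≤ (divisorSum-≤ n m) (divisorTerm-≤ (part n) (1≤part n) m) ⟩
    ℤ.+ (n * m + m)                            ≡⟨ cong ℤ.+_ (ℕ.+-comm (n * m) m) ⟩
    ℤ.+ (m + n * m)                            ∎
    where open ℤ.≤-Reasoning

  divisorSum-stable : ∀ m j → divisorSum (j + m) m ≡ divisorSum m m
  divisorSum-stable m zero    = refl
  divisorSum-stable m (suc j) = trans (cong₂ ℤ._+_ (divisorSum-stable m j)
    (divisorTerm-< (part (j + m)) m (ℕ.<-≤-trans (ℕ.+-mono-≤ 1≤x (ℕ.≤-trans (ℕ.m≤n+m m j) (ℕ.m≤n*m (j + m) r {{>-nonZero 1≤r}})))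
      ℕ.≤-refl)))
    (ℤ.+-identityʳ _)

  -- Only parts up to `m` matter at `q^m`; they are among the first `m` parts, and each contributes
  -- at most `m`. The bound does not depend on `n`, so it survives the passage to the infinite
  -- product.
  divisorSum≼sq : ∀ n → divisorSum n ≼ sq
  divisorSum≼sq n .at≤ m with n ℕ.≤? m
  ... | yes n≤m = ℤ.≤-trans (divisorSum-≤ n m) (ℤ.+≤+ (ℕ.*-monoˡ-≤ m n≤m))
  ... | no  n≰m = begin
    divisorSum n m             ≡⟨ cong (λ k → divisorSum k m) (ℕ.m∸n+n≡m (ℕ.<⇒≤ (ℕ.≰⇒> n≰m))) ⟨
    divisorSum (n ∸ m + m) m   ≡⟨ divisorSum-stable m (n ∸ m) ⟩
    divisorSum m m             ≤⟨ divisorSum-≤ m m ⟩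
    sq m                       ∎
    where open ℤ.≤-Reasoning

  θ-geomProduct-≼ : ∀ n → θ (geomProduct n) ≼ sq ⊛ geomProduct n
  θ-geomProduct-≼ n = ≼-trans (≈⇒≼ (θ-geomProduct n)) (⊛-monoˡ-≼ (geomProduct n) (0≼geomProduct n) (divisorSum≼sq n))

  inv-qPochhammer-mod : ∀ n → inv (qPochhammer x r) ≈ geomProduct n mod-q^ n
  inv-qPochhammer-mod n = mod-trans (inv-mod (qPochhammer-0 x r 1≤x) (Π-0 (qFactor x r) n λ i → qFactor-0 x r i 1≤x)
    (mod-sym (qPochhammer-mod x r n 1≤x 1≤r ℕ.≤-refl)))
    (≈⇒mod (Π-inv (qFactor x r) n λ i → qFactor-0 x r i 1≤x))

-- `sq` occurs twice in `slow`, once for each of the two q-Pochhammer symbols in the denominator.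
record SlowlyGrowing (p : Series) : Set where
  field
    nonneg : 0ₛ ≼ p
    p₀     : p 0 ≡ 1ℤ
    slow   : θ p ≼ (sq ⊕ sq) ⊛ p

slowlyGrowing : ∀ x y r → 1 ≤ x → 1 ≤ y → 1 ≤ r → SlowlyGrowing (inv (qPochhammer x r ⊛ qPochhammer y r))
slowlyGrowing x y r 1≤x 1≤y 1≤r = record { nonneg = nonneg ; p₀ = refl ; slow = slow }
  where
  p = inv (qPochhammer x r ⊛ qPochhammer y r)
  gx = geomProduct x r 1≤x 1≤r
  gy = geomProduct y r 1≤y 1≤r
  0≼gx = 0≼geomProduct x r 1≤x 1≤r
  0≼gy = 0≼geomProduct y r 1≤y 1≤r
  p-mod : ∀ n → p ≈ gx n ⊛ gy n mod-q^ n
  p-mod n = mod-trans (≈⇒mod (inv-⊛ (qPochhammer x r) (qPochhammer y r) (qPochhammer-0 x r 1≤x) (qPochhammer-0 y r 1≤y)))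
    (⊛-mod (inv-qPochhammer-mod x r 1≤x 1≤r n) (inv-qPochhammer-mod y r 1≤y 1≤r n))
  nonneg : 0ₛ ≼ p
  nonneg .at≤ n = subst (0ℤ ℤ.≤_) (sym (p-mod (suc n) .at< n ℕ.≤-refl)) (⊛-nonneg (0≼gx (suc n)) (0≼gy (suc n)) .at≤ n)
  finite : ∀ n → θ (gx n ⊛ gy n) ≼ (sq ⊕ sq) ⊛ (gx n ⊛ gy n)
  finite n = ≼-trans (≈⇒≼ (≈-trans (θ-⊛ (gx n) (gy n)) (⊕-cong (≈-refl {θ (gx n) ⊛ gy n}) (⊛-comm (gx n) (θ (gy n))))))
    (≼-trans (⊕-mono (⊛-monoˡ-≼ (gy n) (0≼gy n) (θ-geomProduct-≼ x r 1≤x 1≤r n))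
                     (⊛-monoˡ-≼ (gx n) (0≼gx n) (θ-geomProduct-≼ y r 1≤y 1≤r n)))
    (≈⇒≼ (solve 3 (λ q g h → q :* g :* h :+ q :* h :* g := (q :+ q) :* (g :* h)) ≈-refl sq (gx n) (gy n))))
    where open S
  slow : θ p ≼ (sq ⊕ sq) ⊛ p
  slow .at≤ n = begin
    ℤ.+ n ℤ.* p n
      ≡⟨ cong (ℤ.+ n ℤ.*_) (p-mod (suc n) .at< n ℕ.≤-refl) ⟩
    θ (gx (suc n) ⊛ gy (suc n)) n                ≤⟨ finite (suc n) .at≤ n ⟩
    ((sq ⊕ sq) ⊛ (gx (suc n) ⊛ gy (suc n))) n
      ≡⟨ ⊛-modˡ (sq ⊕ sq) (p-mod (suc n)) .at< n ℕ.≤-refl ⟨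
    ((sq ⊕ sq) ⊛ p) n                            ∎
    where open ℤ.≤-Reasoning

-- Linear against quadratic weights in convolutions with a slowly growing series

linear : Series
linear n = ℤ.+ (suc n)

module _ {p : Series} (sg : SlowlyGrowing p) where

  open SlowlyGrowing sg

  initial : ℕ → Series
  initial = partialSum q^_ 0

  0≼initial : ∀ t → 0ₛ ≼ initial t
  0≼initial zero    .at≤ n = ℤ.≤-refl
  0≼initial (suc t) .at≤ n = ℤ.+-mono-≤ (0≼initial t .at≤ n) (0≼q^ t .at≤ n)

  1≤initial : ∀ t n → n < t → 1ℤ ℤ.≤ initial t n
  1≤initial (suc t) n (s≤s n≤t) with n ℕ.≟ t
  ... | yes refl = ℤ.+-mono-≤ (0≼initial n .at≤ n) (ℤ.≤-reflexive (sym (q^-e n)))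
  ... | no  n≢t  = ℤ.+-mono-≤ (1≤initial t n (ℕ.≤∧≢⇒< n≤t n≢t)) (0≼q^ t .at≤ n)

  q^⊛sq≼sq : ∀ e → q^ e ⊛ sq ≼ sq
  q^⊛sq≼sq e .at≤ n with e ℕ.≤? n
  ... | no e≰n  = ℤ.≤-trans (ℤ.≤-reflexive (q^-⊛-< e sq n (ℕ.≰⇒> e≰n))) (0≤+ (n * n))
  ... | yes e≤n = ℤ.≤-trans (ℤ.≤-reflexive (trans (cong (q^ e ⊛ sq) (sym (ℕ.m+[n∸m]≡n e≤n))) (q^-⊛-+ e sq (n ∸ e))))
    (ℤ.+≤+ (ℕ.*-mono-≤ (ℕ.m∸n≤m n e) (ℕ.m∸n≤m n e)))

  sq⊛p : Series
  sq⊛p = sq ⊛ p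

  0≼sq⊛p : 0ₛ ≼ sq⊛p
  0≼sq⊛p = ⊛-nonneg (pointwise≤ λ n → 0≤+ (n * n)) nonneg

  -- `slow` at `n - e` bounds `(n - e) p(n - e)` by twice the coefficient of `q^e ⊛ sq ⊛ p` at `n`,
  -- and `q^e ⊛ sq ≼ sq`. The weaker weight `n ∸ t` is common to all `e ≤ t`, so that these bounds
  -- can be added.
  shifted-slow : ∀ e t n → e ≤ t → ℤ.+ (n ∸ t) ℤ.* (q^ e ⊛ p) n ℤ.≤ sq⊛p n ℤ.+ sq⊛p n
  shifted-slow e t n e≤t with e ℕ.≤? n
  ... | no e≰n = begin
    ℤ.+ (n ∸ t) ℤ.* (q^ e ⊛ p) n   ≡⟨ cong (ℤ.+ (n ∸ t) ℤ.*_) (q^-⊛-< e p n (ℕ.≰⇒> e≰n)) ⟩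
    ℤ.+ (n ∸ t) ℤ.* 0ℤ             ≡⟨ ℤ.*-zeroʳ (ℤ.+ (n ∸ t)) ⟩
    0ℤ                             ≤⟨ ℤ.+-mono-≤ (0≼sq⊛p .at≤ n) (0≼sq⊛p .at≤ n) ⟩
    sq⊛p n ℤ.+ sq⊛p n                    ∎
    where open ℤ.≤-Reasoning
  ... | yes e≤n = begin
    ℤ.+ (n ∸ t) ℤ.* (q^ e ⊛ p) n   ≡⟨ cong (ℤ.+ (n ∸ t) ℤ.*_) (shift p) ⟩
    ℤ.+ (n ∸ t) ℤ.* p k            ≤⟨ *-monoʳ (nonneg .at≤ k) (ℤ.+≤+ (ℕ.∸-monoʳ-≤ n e≤t)) ⟩
    θ p k                          ≡⟨ shift (θ p) ⟨
    (q^ e ⊛ θ p) n                 ≡⟨ ⊛-comm (q^ e) (θ p) .at n ⟩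
    (θ p ⊛ q^ e) n                 ≤⟨ ⊛-monoˡ-≼ (q^ e) (0≼q^ e) slow .at≤ n ⟩
    ((sq ⊕ sq) ⊛ p ⊛ q^ e) n
      ≡⟨ solve 3 (λ s p x → (s :+ s) :* p :* x := x :* s :* p :+ x :* s :* p) ≈-refl sq p (q^ e) .at n ⟩
    (q^ e ⊛ sq ⊛ p) n ℤ.+ (q^ e ⊛ sq ⊛ p) n  ≤⟨ ℤ.+-mono-≤ shrink shrink ⟩
    sq⊛p n ℤ.+ sq⊛p n                    ∎
    where
    open S
    open ℤ.≤-Reasoning
    k = n ∸ e
    shift : ∀ f → (q^ e ⊛ f) n ≡ f k
    shift f = trans (cong (q^ e ⊛ f) (sym (ℕ.m+[n∸m]≡n e≤n))) (q^-⊛-+ e f k)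
    shrink : (q^ e ⊛ sq ⊛ p) n ℤ.≤ sq⊛p n
    shrink = ⊛-monoˡ-≼ p nonneg (q^⊛sq≼sq e) .at≤ n

  -- The induction is on the number `t` of summands; `T` is separate so that the weight stays fixed.
  initial-slow : ∀ T t n → t ≤ T → ℤ.+ (n ∸ T) ℤ.* (initial t ⊛ p) n ℤ.≤ ℤ.+ t ℤ.* (sq⊛p n ℤ.+ sq⊛p n)
  initial-slow T zero n _ = ℤ.≤-reflexive (trans (cong (ℤ.+ (n ∸ T) ℤ.*_) (0ₛ⊛ p .at n))
    (trans (ℤ.*-zeroʳ (ℤ.+ (n ∸ T))) (sym (ℤ.*-zeroˡ (sq⊛p n ℤ.+ sq⊛p n)))))
  initial-slow T (suc t) n t<T = begin
    w ℤ.* ((initial t ⊕ q^ t) ⊛ p) n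
      ≡⟨ cong (w ℤ.*_) (⊛-distribʳ (initial t) (q^ t) p .at n) ⟩
    w ℤ.* ((initial t ⊛ p) n ℤ.+ (q^ t ⊛ p) n)
      ≡⟨ ℤ.*-distribˡ-+ w ((initial t ⊛ p) n) ((q^ t ⊛ p) n) ⟩
    w ℤ.* (initial t ⊛ p) n ℤ.+ w ℤ.* (q^ t ⊛ p) n
      ≤⟨ ℤ.+-mono-≤ (initial-slow T t n (ℕ.<⇒≤ t<T)) (shifted-slow t T n (ℕ.<⇒≤ t<T)) ⟩
    ℤ.+ t ℤ.* z ℤ.+ z
      ≡⟨ solve 2 (λ t z → t :* z :+ z := (con 1ℤ :+ t) :* z) refl (ℤ.+ t) z ⟩
    ℤ.+ suc t ℤ.* z                                     ∎
    where
    open +-*-Solver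
    open ℤ.≤-Reasoning
    w = ℤ.+ (n ∸ T)
    z = sq⊛p n ℤ.+ sq⊛p n

  -- Beyond a threshold `T` the quadratic weight wins termwise. The finitely many `m < T` involve
  -- only `p(n - m)` with bounded `m`, and `initial-slow` makes their total small against `sq⊛p n`
  -- once `n` is large.
  linear-⊛-≤-sq-⊛ : ∀ C → ∃ λ N → ∀ n → N ≤ n → ℤ.+ C ℤ.* (linear ⊛ p) n ℤ.≤ (sq ⊛ p) n
  linear-⊛-≤-sq-⊛ C = suc (T * 2 * M) + T , λ n N≤n → ℤ.*-cancelˡ-≤-pos (ℤ.+ C ℤ.* (linear ⊛ p) n) (sq⊛p n) (ℤ.+ 2) (begin
    ℤ.+ 2 ℤ.* (ℤ.+ C ℤ.* (linear ⊛ p) n)       ≡⟨ ℤ.*-assoc (ℤ.+ 2) (ℤ.+ C) _ ⟨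
    (ℤ.+ 2 ℤ.* ℤ.+ C) ℤ.* (linear ⊛ p) n       ≡⟨ cong (ℤ._* (linear ⊛ p) n) (ℤ.pos-* 2 C) ⟨
    ℤ.+ D ℤ.* (linear ⊛ p) n                   ≡⟨ ·-⊛ (ℤ.+ D) linear p .at n ⟨
    ((ℤ.+ D · linear) ⊛ p) n                   ≤⟨ ⊛-monoˡ-≼ p nonneg linear≼ .at≤ n ⟩
    ((sq ⊕ ℤ.+ M · initial T) ⊛ p) n           ≡⟨ ⊛-distribʳ sq (ℤ.+ M · initial T) p .at n ⟩
    sq⊛p n ℤ.+ ((ℤ.+ M · initial T) ⊛ p) n
      ≡⟨ cong (ℤ._+_ (sq⊛p n)) (·-⊛ (ℤ.+ M) (initial T) p .at n) ⟩
    sq⊛p n ℤ.+ ℤ.+ M ℤ.* (initial T ⊛ p) n        ≤⟨ ℤ.+-monoʳ-≤ (sq⊛p n) (small n N≤n) ⟩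
    sq⊛p n ℤ.+ sq⊛p n
      ≡⟨ solve 1 (λ z → z :+ z := con (ℤ.+ 2) :* z) refl (sq⊛p n) ⟩
    ℤ.+ 2 ℤ.* sq⊛p n                              ∎)
    where
    open +-*-Solver
    open ℤ.≤-Reasoning
    -- `C` is doubled because `sq⊛p` is used twice: for the large indices and to absorb the small
    -- ones. For `m ≥ T` one has `D (m + 1) ≤ 2 D m ≤ m^2`, where the `suc` in `T` ensures `m ≥ 1`;
    -- for `m < T`, `M` bounds `D (m + 1)`.
    D = 2 * C
    T = suc (D * 2)
    M = D * T
    linear≼ : ℤ.+ D · linear ≼ sq ⊕ ℤ.+ M · initial T
    linear≼ .at≤ n with T ℕ.≤? n
    ... | yes T≤n = begin
      ℤ.+ D ℤ.* ℤ.+ (suc n)                    ≡⟨ ℤ.pos-* D (suc n) ⟨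
      ℤ.+ (D * suc n)
        ≤⟨ ℤ.+≤+ (ℕ.≤-trans (ℕ.*-monoʳ-≤ D (ℕ.+-monoˡ-≤ n (ℕ.≤-trans (s≤s z≤n) T≤n)))
                                                   (ℕ.≤-trans (ℕ.≤-reflexive (doubling D n)) (ℕ.*-monoˡ-≤ n (ℕ.<⇒≤ T≤n)))) ⟩
      sq n                                     ≡⟨ ℤ.+-identityʳ (sq n) ⟨
      sq n ℤ.+ 0ℤ                              ≡⟨ cong (ℤ._+_ (sq n)) (ℤ.*-zeroʳ (ℤ.+ M)) ⟨
      sq n ℤ.+ ℤ.+ M ℤ.* 0ℤ
        ≤⟨ ℤ.+-monoʳ-≤ (sq n) (*-monoˡ (0≤+ M) (0≼initial T .at≤ n)) ⟩
      sq n ℤ.+ ℤ.+ M ℤ.* initial T n           ∎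
      where
      doubling : ∀ D n → D * (n + n) ≡ D * 2 * n
      doubling = ℕS.solve 2 (λ D n → D ℕS.:* (n ℕS.:+ n) ℕS.:= D ℕS.:* ℕS.con 2 ℕS.:* n) refl
        where module ℕS = ℕ-Solver
    ... | no T≰n = begin
      ℤ.+ D ℤ.* ℤ.+ (suc n)                    ≡⟨ ℤ.pos-* D (suc n) ⟨
      ℤ.+ (D * suc n)                          ≤⟨ ℤ.+≤+ (ℕ.*-monoʳ-≤ D (ℕ.≰⇒> T≰n)) ⟩
      ℤ.+ M                                    ≡⟨ ℤ.*-identityʳ (ℤ.+ M) ⟨
      ℤ.+ M ℤ.* 1ℤ                             ≤⟨ *-monoˡ (0≤+ M) (1≤initial T n (ℕ.≰⇒> T≰n)) ⟩
      ℤ.+ M ℤ.* initial T n                    ≡⟨ ℤ.+-identityˡ (ℤ.+ M ℤ.* initial T n) ⟨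
      0ℤ ℤ.+ ℤ.+ M ℤ.* initial T n
        ≤⟨ ℤ.+-monoˡ-≤ (ℤ.+ M ℤ.* initial T n) (0≤+ (n * n)) ⟩
      sq n ℤ.+ ℤ.+ M ℤ.* initial T n           ∎
    -- The threshold makes `n ∸ T` exceed the factor `2 T M` that `initial-slow` produces.
    small : ∀ n → suc (T * 2 * M) + T ≤ n → ℤ.+ M ℤ.* (initial T ⊛ p) n ℤ.≤ sq⊛p n
    small n N≤n = ℤ.*-cancelˡ-≤-pos (ℤ.+ M ℤ.* y) (sq⊛p n) (ℤ.+ (n ∸ T)) {{ℤ.positive (ℤ.+<+ (ℕ.≤-trans (s≤s z≤n) w≤))}} (begin
      ℤ.+ (n ∸ T) ℤ.* (ℤ.+ M ℤ.* y)
        ≡⟨ solve 3 (λ w m y → w :* (m :* y) := m :* (w :* y)) refl (ℤ.+ (n ∸ T)) (ℤ.+ M) y ⟩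
      ℤ.+ M ℤ.* (ℤ.+ (n ∸ T) ℤ.* y)            ≤⟨ *-monoˡ (0≤+ M) (initial-slow T T n ℕ.≤-refl) ⟩
      ℤ.+ M ℤ.* (ℤ.+ T ℤ.* (sq⊛p n ℤ.+ sq⊛p n))
        ≡⟨ solve 3 (λ m t z → m :* (t :* (z :+ z)) := t :* con (ℤ.+ 2) :* m :* z) refl (ℤ.+ M) (ℤ.+ T) (sq⊛p n) ⟩
      ℤ.+ T ℤ.* ℤ.+ 2 ℤ.* ℤ.+ M ℤ.* sq⊛p n
        ≡⟨ cong (ℤ._* sq⊛p n) (trans (ℤ.pos-* (T * 2) M) (cong (ℤ._* ℤ.+ M) (ℤ.pos-* T 2))) ⟨
      ℤ.+ (T * 2 * M) ℤ.* sq⊛p n                  ≤⟨ *-monoʳ (0≼sq⊛p .at≤ n) (ℤ.+≤+ (ℕ.<⇒≤ w≤)) ⟩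
      ℤ.+ (n ∸ T) ℤ.* sq⊛p n                      ∎)
      where
      y = (initial T ⊛ p) n
      w≤ : suc (T * 2 * M) ≤ n ∸ T
      w≤ = ℕ.m+n≤o⇒m≤o∸n (suc (T * 2 * M)) N≤n

-- Growth of coefficients

infix 4 _∈O_

record _∈O_ (f : Series) (φ : ℕ → ℕ) : Set where
  constructor order
  field
    constant : ℕ
    bound    : ∀ n → ∣ f n ∣ ≤ constant * φ n

-- `suc` instead of the identity, since a constant term need not vanish.
Bounded Linear : Series → Set
Bounded f = f ∈O λ _ → 1
Linear f  = f ∈O suc

module _ {φ : ℕ → ℕ} where

  O-resp : ∀ {f g} → f ≈ g → f ∈O φ → g ∈O φ
  O-resp p (order C b) = order C λ n → subst (λ x → ∣ x ∣ ≤ C * φ n) (p .at n) (b n)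

  O-0 : 0ₛ ∈O φ
  O-0 = order 0 λ n → z≤n

  O-⊕ : ∀ {f g} → f ∈O φ → g ∈O φ → f ⊕ g ∈O φ
  O-⊕ {f} {g} (order C b) (order D c) = order (C + D) λ n →
    ℕ.≤-trans (ℤ.∣i+j∣≤∣i∣+∣j∣ (f n) (g n))
    (ℕ.≤-trans (ℕ.+-mono-≤ (b n) (c n)) (ℕ.≤-reflexive (sym (ℕ.*-distribʳ-+ (φ n) C D))))

  O-⊝ : ∀ {f} → f ∈O φ → ⊝ f ∈O φ
  O-⊝ {f} (order C b) = order C λ n → subst (_≤ C * φ n) (sym (ℤ.∣-i∣≡∣i∣ (f n))) (b n)

  O-⊖ : ∀ {f g} → f ∈O φ → g ∈O φ → f ⊖ g ∈O φ
  O-⊖ p r = O-⊕ p (O-⊝ r)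

  O-const : ∀ c {f} → f ∈O φ → const c ⊛ f ∈O φ
  O-const c {f} (order C b) = O-resp (≈-sym (const-⊛ c f)) (order (∣ c ∣ * C) λ n →
    ℕ.≤-trans (ℕ.≤-reflexive (ℤ.abs-* c (f n)))
    (ℕ.≤-trans (ℕ.*-monoʳ-≤ ∣ c ∣ (b n)) (ℕ.≤-reflexive (sym (ℕ.*-assoc ∣ c ∣ C (φ n))))))

  module _ (φ-mono : ∀ {m n} → m ≤ n → φ m ≤ φ n) where

    O-q^ : ∀ e {f} → f ∈O φ → q^ e ⊛ f ∈O φ
    O-q^ e {f} (order C b) = order C bound
      where
      bound : ∀ n → ∣ (q^ e ⊛ f) n ∣ ≤ C * φ n
      bound n with e ℕ.≤? n
      ... | no  e≰n = ℕ.≤-trans (ℕ.≤-reflexive (cong ∣_∣ (q^-⊛-< e f n (ℕ.≰⇒> e≰n)))) z≤n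
      ... | yes e≤n = ℕ.≤-trans (ℕ.≤-reflexive (cong ∣_∣
        (trans (cong (q^ e ⊛ f) (sym (ℕ.m+[n∸m]≡n e≤n))) (q^-⊛-+ e f (n ∸ e)))))
        (ℕ.≤-trans (b (n ∸ e)) (ℕ.*-monoʳ-≤ C (φ-mono (ℕ.m∸n≤m n e))))

Bounded-unshift : ∀ e {f} → Bounded (q^ e ⊛ f) → Bounded f
Bounded-unshift e {f} (order C b) = order C λ n →
  subst (λ x → ∣ x ∣ ≤ C * 1) (q^-⊛-+ e f n) (b (e + n))

⊛-bounded : ∀ {f g} → Bounded f → Bounded g → Linear (f ⊛ g)
⊛-bounded {f} {g} (order C b) (order D c) = order (C * D) λ n →
    ℕ.≤-trans (go f b n) (ℕ.≤-reflexive (ℕ.*-comm (suc n) (C * D)))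
  where
  product : ∀ x y → ∣ x ∣ ≤ C * 1 → ∣ y ∣ ≤ D * 1 → ∣ x ℤ.* y ∣ ≤ C * D
  product x y p r = ℕ.≤-trans (ℕ.≤-reflexive (ℤ.abs-* x y))
    (ℕ.*-mono-≤ (subst (∣ x ∣ ≤_) (ℕ.*-identityʳ C) p) (subst (∣ y ∣ ≤_) (ℕ.*-identityʳ D) r))
  go : ∀ f → (∀ n → ∣ f n ∣ ≤ C * 1) → ∀ n → ∣ (f ⊛ g) n ∣ ≤ suc n * (C * D)
  go f b zero    = ℕ.≤-trans (ℤ.∣i+j∣≤∣i∣+∣j∣ (f 0 ℤ.* g 0) 0ℤ) (ℕ.+-mono-≤ (product (f 0) (g 0) (b 0) (c 0)) z≤n)
  go f b (suc n) = ℕ.≤-trans (ℤ.∣i+j∣≤∣i∣+∣j∣ (f 0 ℤ.* g (suc n)) (((f ∘ suc) ⊛ g) n))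
    (ℕ.+-mono-≤ (product (f 0) (g (suc n)) (b 0) (c (suc n))) (go (f ∘ suc) (b ∘ suc) n))

-- q-integers and the double pole at 1

geom-bounded : ∀ d → 1 ≤ d → Bounded (geom d)
geom-bounded d 1≤d = order 1 λ n → abs≤1 (geom-bounds d 1≤d n)
  where
  abs≤1 : ∀ {x} → 0ℤ ℤ.≤ x × x ℤ.≤ 1ℤ → ∣ x ∣ ≤ 1
  abs≤1 (ℤ.+≤+ _ , ℤ.+≤+ x≤1) = x≤1

-- The q-integer `(1 - q^(e n)) / (1 - q^e)`, a polynomial with value `n` at `q = 1`.
[_]_ : ℕ → ℕ → Series
[ n ] e = partialSum (λ i → q^ (e * i)) 0 n

[]-telescope : ∀ n e → 1−q^ e ⊛ [ n ] e ≈ 1−q^ (e * n)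
[]-telescope zero    e = ≈-trans (solve 1 (λ x → x :* con 0ℤ := con 1ℤ :- con 1ℤ) ≈-refl (1−q^ e))
  (⊖-cong (≈-refl {1ₛ}) (q^-cong (sym (ℕ.*-zeroʳ e))))
  where open S
[]-telescope (suc n) e = begin
  1−q^ e ⊛ ([ n ] e ⊕ q^ (e * n))
    ≈⟨ solve 3 (λ x y z → x :* (y :+ z) := x :* y :+ x :* z) ≈-refl (1−q^ e) ([ n ] e) (q^ (e * n)) ⟩
  1−q^ e ⊛ [ n ] e ⊕ 1−q^ e ⊛ q^ (e * n)
    ≈⟨ ⊕-cong ([]-telescope n e) (≈-refl {1−q^ e ⊛ q^ (e * n)}) ⟩
  1−q^ (e * n) ⊕ 1−q^ e ⊛ q^ (e * n)
    ≈⟨ solve 2 (λ x y → con 1ℤ :- y :+ (con 1ℤ :- x) :* y := con 1ℤ :- x :* y) ≈-refl (q^ e) (q^ (e * n)) ⟩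
  1ₛ ⊖ q^ e ⊛ q^ (e * n)
    ≈⟨ ⊖-cong (≈-refl {1ₛ}) (≈-trans (q^-+ e (e * n)) (q^-cong (sym (ℕ.*-suc e n)))) ⟩
  1−q^ (e * suc n)                                ∎
  where
  open S
  open ≈-Reasoning

bounded-[] : ∀ n e {f} → Bounded f → Bounded ([ n ] e ⊛ f)
bounded-[] zero    e {f} b = O-resp (≈-sym (0ₛ⊛ f)) O-0
bounded-[] (suc n) e {f} b = O-resp (≈-sym (⊛-distribʳ ([ n ] e) (q^ (e * n)) f))
  (O-⊕ (bounded-[] n e b) (O-q^ (λ _ → ℕ.≤-refl) (e * n) b))

-- The pole of 1 / ((1 - q^a)(1 - q^b)) at 1 is the only one of order 2, so that multiplication
-- by 1 - q leaves bounded coefficients.  If x a = 1 + y b then, more explicitly,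
-- q^(y b) (1 - q) = (1 - q^(x a)) - (1 - q^(y b)).
bézout-bounded : ∀ a b x y → 1 ≤ a → 1 ≤ b → 1 + y * b ≡ x * a → Bounded (1−q^ 1 ⊛ (geom a ⊛ geom b))
bézout-bounded a b x y 1≤a 1≤b eq = Bounded-unshift (b * y) (O-resp (≈-sym expand)
  (O-⊖ (bounded-[] x a (geom-bounded b 1≤b)) (bounded-[] y b (geom-bounded a 1≤a))))
  where
  open S
  open ≈-Reasoning
  ga = geom a
  gb = geom b
  expand : q^ (b * y) ⊛ (1−q^ 1 ⊛ (ga ⊛ gb)) ≈ [ x ] a ⊛ gb ⊖ [ y ] b ⊛ ga
  expand = begin
    q^ (b * y) ⊛ (1−q^ 1 ⊛ (ga ⊛ gb))
      ≈⟨ solve 4 (λ x q g h → x :* ((con 1ℤ :- q) :* (g :* h)) := ((con 1ℤ :- x :* q) :- (con 1ℤ :- x)) :* (g :* h))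
           ≈-refl (q^ (b * y)) (q^ 1) ga gb ⟩
    (1ₛ ⊖ q^ (b * y) ⊛ q^ 1 ⊖ 1−q^ (b * y)) ⊛ (ga ⊛ gb)
      ≈⟨ ⊛-congʳ (ga ⊛ gb) (⊖-cong (⊖-cong (≈-refl {1ₛ}) (≈-trans (q^-+ (b * y) 1) (q^-cong exponents)))
           (≈-sym ([]-telescope y b))) ⟩
    (1−q^ (a * x) ⊖ 1−q^ b ⊛ [ y ] b) ⊛ (ga ⊛ gb)
      ≈⟨ ⊛-congʳ (ga ⊛ gb) (⊖-cong (≈-sym ([]-telescope x a)) (≈-refl {1−q^ b ⊛ [ y ] b})) ⟩
    (1−q^ a ⊛ [ x ] a ⊖ 1−q^ b ⊛ [ y ] b) ⊛ (ga ⊛ gb)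
      ≈⟨ solve 6 (λ u v s t g h → (u :* s :- v :* t) :* (g :* h) := (g :* u) :* (s :* h) :- (h :* v) :* (t :* g))
           ≈-refl (1−q^ a) (1−q^ b) ([ x ] a) ([ y ] b) ga gb ⟩
    (ga ⊛ 1−q^ a) ⊛ ([ x ] a ⊛ gb) ⊖ (gb ⊛ 1−q^ b) ⊛ ([ y ] b ⊛ ga)
      ≈⟨ ⊖-cong (≈-trans (⊛-congʳ ([ x ] a ⊛ gb) (geom-inverse a 1≤a)) (⊛-identityˡ ([ x ] a ⊛ gb)))
                (≈-trans (⊛-congʳ ([ y ] b ⊛ ga) (geom-inverse b 1≤b)) (⊛-identityˡ ([ y ] b ⊛ ga))) ⟩
    [ x ] a ⊛ gb ⊖ [ y ] b ⊛ ga ∎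
    where
    exponents : b * y + 1 ≡ a * x
    exponents = trans (ℕ.+-comm (b * y) 1) (trans (cong suc (ℕ.*-comm b y)) (trans eq (ℕ.*-comm x a)))

coprime-bounded : ∀ a b → 1 ≤ a → 1 ≤ b → Coprime a b → Bounded (1−q^ 1 ⊛ (geom a ⊛ geom b))
coprime-bounded a b 1≤a 1≤b cop with coprime-Bézout cop
... | Bézout.+- x y eq = bézout-bounded a b x y 1≤a 1≤b eq
-- The opposite sign in Bézout's identity exchanges the roles of `a` and `b`.
... | Bézout.-+ x y eq = O-resp (⊛-congˡ (1−q^ 1) (⊛-comm (geom b) (geom a))) (bézout-bounded b a y x 1≤b 1≤a eq)

-- Comparison of `G v` with `1 / (1 - q)^3` up to linear growth

module Residue (a b c : ℕ) (1≤a : 1 ≤ a) (1≤b : 1 ≤ b) (1≤c : 1 ≤ c) (a⊥b : Coprime a b) where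

  v : Series
  v = geom a ⊛ geom b ⊛ geom c

  Δv-linear : Linear (1−q^ 1 ⊛ v)
  Δv-linear = O-resp (solve 4 (λ x f g h → x :* (f :* g) :* h := x :* (f :* g :* h)) ≈-refl (1−q^ 1) (geom a) (geom b) (geom c))
    (⊛-bounded (coprime-bounded a b 1≤a 1≤b a⊥b) (geom-bounded c 1≤c))
    where open S

  -- Holds for polynomials G with G(1) = κ: up to linear growth, G acts on v as its value at 1,
  -- because (1 - q) v grows linearly.
  record ValueAt1 (G : Series) (κ : ℤ) : Set where
    field
      preserves : ∀ {f} → Linear f → Linear (G ⊛ f)
      value     : Linear (G ⊛ v ⊖ const κ ⊛ v)

  open ValueAt1

  Linear-q^ : ∀ e {f} → Linear f → Linear (q^ e ⊛ f)
  Linear-q^ = O-q^ s≤s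

  -- Telescoping: each further factor `q` changes `q^e v` by `q^e (1 - q) v`, which grows linearly.
  at1-q^ : ∀ e → ValueAt1 (q^ e) 1ℤ
  at1-q^ e .preserves = Linear-q^ e
  at1-q^ zero .value = O-resp (solve 1 (λ v → con 0ℤ := con 1ℤ :* v :- con 1ℤ :* v) ≈-refl v) O-0
    where open S
  at1-q^ (suc e) .value = O-resp (begin
      (q^ e ⊛ v ⊖ 1ₛ ⊛ v) ⊖ q^ e ⊛ (1−q^ 1 ⊛ v)
        ≈⟨ solve 3 (λ x y v → (x :* v :- con 1ℤ :* v) :- x :* ((con 1ℤ :- y) :* v) := y :* x :* v :- con 1ℤ :* v)
             ≈-refl (q^ e) (q^ 1) v ⟩
      q^ 1 ⊛ q^ e ⊛ v ⊖ 1ₛ ⊛ v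
        ≈⟨ ⊖-cong (⊛-congʳ v (q^-+ 1 e)) (≈-refl {1ₛ ⊛ v}) ⟩
      q^ suc e ⊛ v ⊖ 1ₛ ⊛ v ∎)
    (O-⊖ (at1-q^ e .value) (Linear-q^ e Δv-linear))
    where
    open S
    open ≈-Reasoning

  at1-0 : ValueAt1 0ₛ 0ℤ
  at1-0 .preserves {f} _ = O-resp (≈-sym (0ₛ⊛ f)) O-0
  at1-0 .value = O-resp (solve 1 (λ v → con 0ℤ := con 0ℤ :* v :- con 0ℤ :* v) ≈-refl v) O-0
    where open S

  at1-⊕ : ∀ {G H κ μ} → ValueAt1 G κ → ValueAt1 H μ → ValueAt1 (G ⊕ H) (κ ℤ.+ μ)
  at1-⊕ {G} {H} g h .preserves {f} l = O-resp (≈-sym (⊛-distribʳ G H f)) (O-⊕ (g .preserves l) (h .preserves l))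
  at1-⊕ {G} {H} {κ} {μ} g h .value = O-resp (begin
      (G ⊛ v ⊖ const κ ⊛ v) ⊕ (H ⊛ v ⊖ const μ ⊛ v)
        ≈⟨ solve 5 (λ G H k m v → (G :* v :- k :* v) :+ (H :* v :- m :* v) := (G :+ H) :* v :- (k :+ m) :* v)
             ≈-refl G H (const κ) (const μ) v ⟩
      (G ⊕ H) ⊛ v ⊖ (const κ ⊕ const μ) ⊛ v
        ≈⟨ ⊖-cong (≈-refl {(G ⊕ H) ⊛ v}) (⊛-congʳ v (≈-sym (const-⊕ κ μ))) ⟩
      (G ⊕ H) ⊛ v ⊖ const (κ ℤ.+ μ) ⊛ v ∎)
    (O-⊕ (g .value) (h .value))
    where
    open S
    open ≈-Reasoning

  at1-⊝ : ∀ {G κ} → ValueAt1 G κ → ValueAt1 (⊝ G) (ℤ.- κ)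
  at1-⊝ {G} g .preserves {f} l = O-resp (solve 2 (λ G f → :- (G :* f) := (:- G) :* f) ≈-refl G f) (O-⊝ (g .preserves l))
    where open S
  at1-⊝ {G} {κ} g .value = O-resp (begin
      ⊝ (G ⊛ v ⊖ const κ ⊛ v)
        ≈⟨ solve 3 (λ G k v → :- (G :* v :- k :* v) := (:- G) :* v :- (:- k) :* v) ≈-refl G (const κ) v ⟩
      ⊝ G ⊛ v ⊖ ⊝ const κ ⊛ v
        ≈⟨ ⊖-cong (≈-refl {⊝ G ⊛ v}) (⊛-congʳ v (≈-sym (const-⊝ κ))) ⟩
      ⊝ G ⊛ v ⊖ const (ℤ.- κ) ⊛ v ∎)
    (O-⊝ (g .value))
    where
    open S
    open ≈-Reasoning

  -- `G H v - κ μ v = G (H v - μ v) + μ (G v - κ v)`; the first summand is why `ValueAt1` also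
  -- records that linear growth is preserved.
  at1-⊛ : ∀ {G H κ μ} → ValueAt1 G κ → ValueAt1 H μ → ValueAt1 (G ⊛ H) (κ ℤ.* μ)
  at1-⊛ {G} {H} g h .preserves {f} l = O-resp (≈-sym (⊛-assoc G H f)) (g .preserves (h .preserves l))
  at1-⊛ {G} {H} {κ} {μ} g h .value = O-resp (begin
      G ⊛ (H ⊛ v ⊖ const μ ⊛ v) ⊕ const μ ⊛ (G ⊛ v ⊖ const κ ⊛ v)
        ≈⟨ solve 5 (λ G H k m v → G :* (H :* v :- m :* v) :+ m :* (G :* v :- k :* v) := G :* H :* v :- k :* m :* v)
             ≈-refl G H (const κ) (const μ) v ⟩
      G ⊛ H ⊛ v ⊖ const κ ⊛ const μ ⊛ v
        ≈⟨ ⊖-cong (≈-refl {G ⊛ H ⊛ v}) (⊛-congʳ v (≈-sym (const-⊛-const κ μ))) ⟩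
      G ⊛ H ⊛ v ⊖ const (κ ℤ.* μ) ⊛ v ∎)
    (O-⊕ (g .preserves (h .value)) (O-const μ (g .value)))
    where
    open S
    open ≈-Reasoning

  at1-[] : ∀ n e → ValueAt1 ([ n ] e) (ℤ.+ n)
  at1-[] zero    e = at1-0
  at1-[] (suc n) e = subst (λ m → ValueAt1 ([ suc n ] e) (ℤ.+ m)) (ℕ.+-comm n 1)
    (at1-⊕ (at1-[] n e) (at1-q^ (e * n)))

  -- [a][b][c] v = 1 / (1 - q)^3, the coefficients of which are explicit.
  ι : Series
  ι = geom 1

  []⊛geom : ∀ d → 1 ≤ d → [ d ] 1 ⊛ geom d ≈ ι
  []⊛geom d 1≤d = inv-unique (1−q^ 1) ([ d ] 1 ⊛ geom d) refl (begin
    [ d ] 1 ⊛ geom d ⊛ 1−q^ 1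
      ≈⟨ solve 3 (λ x y z → x :* y :* z := y :* (z :* x)) ≈-refl ([ d ] 1) (geom d) (1−q^ 1) ⟩
    geom d ⊛ (1−q^ 1 ⊛ [ d ] 1)
      ≈⟨ ⊛-congˡ (geom d) (≈-trans ([]-telescope d 1) (≡⇒≈ (cong 1−q^_ (ℕ.*-identityˡ d)))) ⟩
    geom d ⊛ 1−q^ d                 ≈⟨ geom-inverse d 1≤d ⟩
    1ₛ                              ∎)
    where
    open S
    open ≈-Reasoning

  ι³ : Series
  ι³ = ι ⊛ (ι ⊛ ι)

  abc : ℤ
  abc = ℤ.+ a ℤ.* ℤ.+ b ℤ.* ℤ.+ c

  -- The product of the three q-integers turns `v` into `ι³` exactly, while up to linear growth it
  -- acts as its value `a b c` at 1.
  ι³≈abc·v : Linear (ι³ ⊖ const abc ⊛ v)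
  ι³≈abc·v = O-resp (⊖-cong {aₛ ⊛ bₛ ⊛ cₛ ⊛ v} {ι³} {const abc ⊛ v} {const abc ⊛ v} (begin
      aₛ ⊛ bₛ ⊛ cₛ ⊛ v
        ≈⟨ ⊛-interchange₃ aₛ bₛ cₛ (geom a) (geom b) (geom c) ⟩
      (aₛ ⊛ geom a) ⊛ (bₛ ⊛ geom b) ⊛ (cₛ ⊛ geom c)
        ≈⟨ ⊛-cong {(aₛ ⊛ geom a) ⊛ (bₛ ⊛ geom b)} {ι ⊛ ι} {cₛ ⊛ geom c} {ι}
             (⊛-cong {aₛ ⊛ geom a} {ι} {bₛ ⊛ geom b} {ι} ([]⊛geom a 1≤a) ([]⊛geom b 1≤b)) ([]⊛geom c 1≤c) ⟩
      ι ⊛ ι ⊛ ι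
        ≈⟨ ⊛-assoc ι ι ι ⟩
      ι³ ∎) (≈-refl {const abc ⊛ v}))
    (at1-⊛ (at1-⊛ (at1-[] a 1) (at1-[] b 1)) (at1-[] c 1) .value)
    where
    aₛ = [ a ] 1
    bₛ = [ b ] 1
    cₛ = [ c ] 1
    open ≈-Reasoning

  ι⊛-suc : ∀ f n → (ι ⊛ f) (suc n) ≡ f (suc n) ℤ.+ (ι ⊛ f) n
  ι⊛-suc f n = trans (step .at (suc n)) (cong (ℤ._+_ (f (suc n))) (q^-⊛-+ 1 (ι ⊛ f) n))
    where
    open S
    step : ι ⊛ f ≈ f ⊕ q^ 1 ⊛ (ι ⊛ f)
    step = ≈-trans (⊛-congʳ f (geom-step 1 ℕ.≤-refl))
      (solve 3 (λ x g f → (con 1ℤ :+ x :* g) :* f := f :+ x :* (g :* f)) ≈-refl (q^ 1) ι f)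

  ι-1 : ∀ n → ι n ≡ 1ℤ
  ι-1 zero    = refl
  ι-1 (suc n) = trans (geom-≥ 1 ℕ.≤-refl n (s≤s z≤n)) (ι-1 n)

  ι²-linear : ∀ n → (ι ⊛ ι) n ≡ linear n
  ι²-linear zero    = refl
  ι²-linear (suc n) = trans (ι⊛-suc ι n) (cong₂ ℤ._+_ (ι-1 (suc n)) (ι²-linear n))

  -- The coefficient is the binomial coefficient of `n + 2` over 2, doubled to avoid a division.
  2ι³ : ∀ n → ℤ.+ 2 ℤ.* ι³ n ≡ linear n ℤ.* linear (suc n)
  2ι³ zero    = refl
  2ι³ (suc n) = begin
    ℤ.+ 2 ℤ.* ι³ (suc n)
      ≡⟨ cong (ℤ.+ 2 ℤ.*_) (trans (ι⊛-suc (ι ⊛ ι) n) (cong (ℤ._+ ι³ n) (ι²-linear (suc n)))) ⟩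
    ℤ.+ 2 ℤ.* (linear (suc n) ℤ.+ ι³ n)
      ≡⟨ ℤ.*-distribˡ-+ (ℤ.+ 2) (linear (suc n)) (ι³ n) ⟩
    ℤ.+ 2 ℤ.* linear (suc n) ℤ.+ ℤ.+ 2 ℤ.* ι³ n
      ≡⟨ cong (ℤ._+_ (ℤ.+ 2 ℤ.* linear (suc n))) (2ι³ n) ⟩
    ℤ.+ 2 ℤ.* linear (suc n) ℤ.+ linear n ℤ.* linear (suc n)
      ≡⟨ solve 1 (λ n → con (ℤ.+ 2) :* (con (ℤ.+ 2) :+ n) :+ (con 1ℤ :+ n) :* (con (ℤ.+ 2) :+ n)
                                                                  := (con (ℤ.+ 2) :+ n) :* (con (ℤ.+ 3) :+ n)) refl (ℤ.+ n) ⟩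
    linear (suc n) ℤ.* linear (suc (suc n))                  ∎
    where
    open +-*-Solver
    open ≡-Reasoning

  sq≤2ι³ : ∀ n → sq n ℤ.≤ ℤ.+ 2 ℤ.* ι³ n
  sq≤2ι³ n = ℤ.≤-trans (ℤ.+≤+ (ℕ.*-mono-≤ (ℕ.n≤1+n n) (ℕ.m≤n⇒m≤1+n (ℕ.n≤1+n n))))
    (ℤ.≤-reflexive (trans (ℤ.pos-* (suc n) (suc (suc n))) (sym (2ι³ n))))

  i≤∣i∣ : ∀ i → i ℤ.≤ ℤ.+ ∣ i ∣
  i≤∣i∣ (ℤ.+ n)    = ℤ.≤-refl
  i≤∣i∣ ℤ.-[1+ n ] = ℤ.-≤+

  ∣i-j∣≤⇒j-B≤i : ∀ {i j} B → ∣ i ℤ.- j ∣ ≤ B → j ℤ.- ℤ.+ B ℤ.≤ i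
  ∣i-j∣≤⇒j-B≤i {i} {j} B p = begin
    j ℤ.- ℤ.+ B
      ≤⟨ ℤ.+-monoʳ-≤ j (ℤ.neg-mono-≤ (ℤ.≤-trans (i≤∣i∣ (j ℤ.- i)) (ℤ.+≤+ (subst (_≤ B) (ℤ.∣i-j∣≡∣j-i∣ i j) p)))) ⟩
    j ℤ.- (j ℤ.- i)            ≡⟨ solve 2 (λ i j → j :- (j :- i) := i) refl i j ⟩
    i                          ∎
    where
    open +-*-Solver
    open ℤ.≤-Reasoning

  module LowerBound {G : Series} (k : ℕ) (1≤k : 1 ≤ k) (g : ValueAt1 G (ℤ.+ k)) where

    -- The two comparisons are combined so that `v` itself drops out, leaving `abc G v - k ι³`.
    difference : Series
    difference = const abc ⊛ (G ⊛ v ⊖ const (ℤ.+ k) ⊛ v) ⊖ const (ℤ.+ k) ⊛ (ι³ ⊖ const abc ⊛ v)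

    difference-linear : Linear (const (ℤ.+ 2) ⊛ difference)
    difference-linear = O-const (ℤ.+ 2) (O-⊖ (O-const abc (g .value)) (O-const (ℤ.+ k) ι³≈abc·v))

    difference≈ : difference ≈ const abc ⊛ (G ⊛ v) ⊖ const (ℤ.+ k) ⊛ ι³
    difference≈ = solve 5 (λ A w k j v → A :* (w :- k :* v) :- k :* (j :- A :* v) := A :* w :- k :* j)
      ≈-refl (const abc) (G ⊛ v) (const (ℤ.+ k)) ι³ v
      where open S

    open _∈O_ difference-linear public using () renaming (constant to C)

    difference-at : ∀ n → (const (ℤ.+ 2) ⊛ difference) n ≡
                    ℤ.+ 2 ℤ.* (abc ℤ.* (G ⊛ v) n) ℤ.- ℤ.+ k ℤ.* (ℤ.+ 2 ℤ.* ι³ n)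
    difference-at n = begin
      (const (ℤ.+ 2) ⊛ difference) n        ≡⟨ const-⊛ (ℤ.+ 2) difference .at n ⟩
      ℤ.+ 2 ℤ.* difference n                ≡⟨ cong (ℤ.+ 2 ℤ.*_) (trans (difference≈ .at n)
                                                 (cong₂ ℤ._-_ (const-⊛ abc (G ⊛ v) .at n) (const-⊛ (ℤ.+ k) ι³ .at n))) ⟩
      ℤ.+ 2 ℤ.* (abc ℤ.* (G ⊛ v) n ℤ.- ℤ.+ k ℤ.* ι³ n)
        ≡⟨ solve 3 (λ x k j → con (ℤ.+ 2) :* (x :- k :* j) := con (ℤ.+ 2) :* x :- k :* (con (ℤ.+ 2) :* j)) refl
             (abc ℤ.* (G ⊛ v) n) (ℤ.+ k) (ι³ n) ⟩
      ℤ.+ 2 ℤ.* (abc ℤ.* (G ⊛ v) n) ℤ.- ℤ.+ k ℤ.* (ℤ.+ 2 ℤ.* ι³ n) ∎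
      where
      open +-*-Solver
      open ≡-Reasoning

    sq≤k·2ι³ : ∀ n → sq n ℤ.≤ ℤ.+ k ℤ.* (ℤ.+ 2 ℤ.* ι³ n)
    sq≤k·2ι³ n = begin
      sq n                            ≤⟨ sq≤2ι³ n ⟩
      ℤ.+ 2 ℤ.* ι³ n                  ≡⟨ ℤ.*-identityˡ (ℤ.+ 2 ℤ.* ι³ n) ⟨
      1ℤ ℤ.* (ℤ.+ 2 ℤ.* ι³ n)         ≤⟨ *-monoʳ (ℤ.≤-trans (0≤+ (n * n)) (sq≤2ι³ n)) (ℤ.+≤+ 1≤k) ⟩
      ℤ.+ k ℤ.* (ℤ.+ 2 ℤ.* ι³ n)      ∎
      where open ℤ.≤-Reasoning

    lower-bound : ∀ n → sq n ℤ.- ℤ.+ C ℤ.* linear n ℤ.≤ ℤ.+ 2 ℤ.* (abc ℤ.* (G ⊛ v) n)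
    lower-bound n = begin
      sq n ℤ.- ℤ.+ C ℤ.* linear n                       ≡⟨ cong (ℤ._-_ (sq n)) (ℤ.pos-* C (suc n)) ⟨
      sq n ℤ.- ℤ.+ (C * suc n)
        ≤⟨ ℤ.+-monoˡ-≤ (ℤ.- (ℤ.+ (C * suc n))) (sq≤k·2ι³ n) ⟩
      ℤ.+ k ℤ.* (ℤ.+ 2 ℤ.* ι³ n) ℤ.- ℤ.+ (C * suc n)    ≤⟨ ∣i-j∣≤⇒j-B≤i (C * suc n)
                                                             (subst (λ x → ∣ x ∣ ≤ C * suc n) (difference-at n) (_∈O_.bound difference-linear n)) ⟩
      ℤ.+ 2 ℤ.* (abc ℤ.* (G ⊛ v) n)                     ∎
      where open ℤ.≤-Reasoning

-- The coefficients of (q^r ; q^r)_∞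

q^-0∨1 : ∀ e n → (q^ e) n ≡ 0ℤ ⊎ (q^ e) n ≡ 1ℤ
q^-0∨1 e n with e ℕ.≟ n
... | yes refl = inj₂ (q^-e e)
... | no  e≢n  = inj₁ (q^-≢ e n e≢n)

∣q^-q^∣≤1 : ∀ d e n → ∣ (q^ d ⊖ q^ e) n ∣ ≤ 1
∣q^-q^∣≤1 d e n = cases (q^-0∨1 d n) (q^-0∨1 e n)
  where
  cases : ∀ {x y} → x ≡ 0ℤ ⊎ x ≡ 1ℤ → y ≡ 0ℤ ⊎ y ≡ 1ℤ → ∣ x ℤ.- y ∣ ≤ 1
  cases (inj₁ refl) (inj₁ refl) = z≤n
  cases (inj₁ refl) (inj₂ refl) = s≤s z≤n
  cases (inj₂ refl) (inj₁ refl) = s≤s z≤n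
  cases (inj₂ refl) (inj₂ refl) = z≤n

∣-1^∣ : ∀ j → ∣ -1ℤ ℤ.^ j ∣ ≡ 1
∣-1^∣ zero    = refl
∣-1^∣ (suc j) = trans (ℤ.abs-* -1ℤ (-1ℤ ℤ.^ j)) (trans (ℕ.*-identityˡ _) (∣-1^∣ j))

∣thetaTerm∣≤1 : ∀ r s j n → ∣ thetaTerm r s j n ∣ ≤ 1
∣thetaTerm∣≤1 r s j n = ℕ.≤-trans
  (ℕ.≤-reflexive (trans (ℤ.abs-* (-1ℤ ℤ.^ j) x) (trans (cong (_* ∣ x ∣) (∣-1^∣ j)) (ℕ.*-identityˡ ∣ x ∣))))
  (∣q^-q^∣≤1 (exponent r j ∸ s * j) (exponent r j + (j + 1) * s) n)
  where x = (q^ (exponent r j ∸ s * j) ⊖ q^ (exponent r j + (j + 1) * s)) n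

-- The coefficient of `q^n` in the limit is read off from `n + 1` terms, and each contributes at
-- most 1 in absolute value.
theta-linear : ∀ r s → Linear (sumFrom 0 (thetaTerm r s))
theta-linear r s = order 1 λ n → ℕ.≤-trans (go n (suc n)) (ℕ.≤-reflexive (sym (ℕ.*-identityˡ (suc n))))
  where
  go : ∀ n N → ∣ partialSum (thetaTerm r s) 0 N n ∣ ≤ N
  go n zero    = z≤n
  go n (suc N) = ℕ.≤-trans (ℤ.∣i+j∣≤∣i∣+∣j∣ (partialSum (thetaTerm r s) 0 N n) (thetaTerm r s N n))
    (ℕ.≤-trans (ℕ.+-mono-≤ (go n N) (∣thetaTerm∣≤1 r s N n)) (ℕ.≤-reflexive (ℕ.+-comm N 1)))

Π-trisect : ∀ f n → partialProduct f (n * 3) ≈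
            partialProduct (λ i → f (i * 3)) n ⊛ partialProduct (λ i → f (1 + i * 3)) n
            ⊛ partialProduct (λ i → f (2 + i * 3)) n
Π-trisect f zero    = ≈-sym (≈-trans (⊛-congʳ 1ₛ (⊛-identityˡ 1ₛ)) (⊛-identityˡ 1ₛ))
Π-trisect f (suc n) = begin
  X ⊛ f₀ ⊛ f₁ ⊛ f₂
    ≈⟨ solve 4 (λ x f g h → x :* f :* g :* h := x :* (f :* g :* h)) ≈-refl X f₀ f₁ f₂ ⟩
  X ⊛ (f₀ ⊛ f₁ ⊛ f₂)            ≈⟨ ⊛-congʳ (f₀ ⊛ f₁ ⊛ f₂) {X} {P₀ ⊛ P₁ ⊛ P₂} (Π-trisect f n) ⟩
  P₀ ⊛ P₁ ⊛ P₂ ⊛ (f₀ ⊛ f₁ ⊛ f₂)  ≈⟨ ⊛-interchange₃ P₀ P₁ P₂ f₀ f₁ f₂ ⟩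
  (P₀ ⊛ f₀) ⊛ (P₁ ⊛ f₁) ⊛ (P₂ ⊛ f₂) ∎
  where
  f₀ = f (n * 3)
  f₁ = f (1 + n * 3)
  f₂ = f (2 + n * 3)
  X  = partialProduct f (n * 3)
  P₀ = partialProduct (λ i → f (i * 3)) n
  P₁ = partialProduct (λ i → f (1 + i * 3)) n
  P₂ = partialProduct (λ i → f (2 + i * 3)) n
  open S
  open ≈-Reasoning

-- Identifies the triple product for (3 r, r) as Euler's pentagonal number theorem in q^r.
qPochhammer-trisect : ∀ r → 1 ≤ r → denominator (3 * r) r ⊛ qPochhammer (3 * r) (3 * r) ≈ qPochhammer r r
qPochhammer-trisect r 1≤r = mod⇒≈ λ N → mod-sym
  (mod-trans (mod-sym (qPochhammer-mod r r (N * 3) 1≤r 1≤r (ℕ.m≤m*n N 3)))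
  (mod-trans (≈⇒mod (Π-trisect (qFactor r r) N))
  (⊛-mod (⊛-mod (factor N r 1≤r 0 (sym (ℕ.+-identityʳ r))) (factor N (3 * r ∸ r) 1≤3r-r 1 3r-r)) (factor N (3 * r) 1≤3r 2 refl))))
  where
  open ℕ-Solver
  1≤3r : 1 ≤ 3 * r
  1≤3r = ℕ.≤-trans 1≤r (ℕ.m≤n*m r 3)
  3r-r : 3 * r ∸ r ≡ r + 1 * r
  3r-r = ℕ.m+n∸m≡n r (2 * r)
  1≤3r-r : 1 ≤ 3 * r ∸ r
  1≤3r-r = subst (1 ≤_) (sym 3r-r) (ℕ.≤-trans 1≤r (ℕ.m≤m+n r (1 * r)))
  exponents : ∀ r i j → r + r * (j + i * 3) ≡ r + j * r + 3 * r * i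
  exponents = solve 3 (λ r i j → r :+ r :* (j :+ i :* con 3) := r :+ j :* r :+ con 3 :* r :* i) refl
  factor : ∀ N x → 1 ≤ x → ∀ j → x ≡ r + j * r → partialProduct (λ i → qFactor r r (j + i * 3)) N ≈ qPochhammer x (3 * r) mod-q^ N
  factor N x 1≤x j refl = mod-trans (≈⇒mod (Π-cong N λ i → ≡⇒≈ (cong 1−q^_ (exponents r i j))))
    (qPochhammer-mod x (3 * r) N 1≤x 1≤3r ℕ.≤-refl)

qPochhammer-linear : ∀ r → 1 ≤ r → Linear (qPochhammer r r)
qPochhammer-linear r 1≤r = O-resp (≈-trans
  (jacobi-triple-product (3 * r) r 1≤r (ℕ.*-monoˡ-< r {{>-nonZero 1≤r}} {2} {3} ℕ.≤-refl)) (qPochhammer-trisect r 1≤r))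
  (theta-linear (3 * r) r)

sgn-linear : ∀ k {f} → Linear f → Linear (sgn k ⊛ f)
sgn-linear zero    {f} l = O-resp (≈-sym (⊛-identityˡ f)) l
sgn-linear (suc k) {f} l = O-resp (solve 2 (λ x f → :- (x :* f) := (:- x) :* f) ≈-refl (sgn k) f) (O-⊝ (sgn-linear k l))
  where open S

inverse-⊛ : ∀ f f′ g g′ → f ⊛ f′ ≈ 1ₛ → g ⊛ g′ ≈ 1ₛ → (f ⊛ g) ⊛ (f′ ⊛ g′) ≈ 1ₛ
inverse-⊛ f f′ g g′ p r = begin
  (f ⊛ g) ⊛ (f′ ⊛ g′)  ≈⟨ ⊛-interchange f g f′ g′ ⟩
  (f ⊛ f′) ⊛ (g ⊛ g′)  ≈⟨ ⊛-cong {f ⊛ f′} {1ₛ} {g ⊛ g′} {1ₛ} p r ⟩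
  1ₛ ⊛ 1ₛ              ≈⟨ ⊛-identityˡ 1ₛ ⟩
  1ₛ                   ∎
  where
  open ≈-Reasoning

sgn² : ∀ k → sgn k ⊛ sgn k ≈ 1ₛ
sgn² zero    = ⊛-identityˡ 1ₛ
sgn² (suc k) = ≈-trans (solve 1 (λ x → (:- x) :* (:- x) := x :* x) ≈-refl (sgn k)) (sgn² k)
  where open S

-- Head and tail of the theta series

numerator-tail : ∀ r s k → 2 * s < r →
                 numerator r s k ≈ sumFrom 0 (thetaTerm r s) ⊖ partialSum (thetaTerm r s) 0 k
numerator-tail r s k 2s<r .at n = sym (begin
  sumFrom 0 t n ℤ.- partialSum t 0 k n
    -- By convergence the full sum may be read off after `k + (n + 1)` terms, which splits into the
    -- head and the partial sum that defines the tail at `q^n`.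
    ≡⟨ cong (ℤ._- partialSum t 0 k n) (trans (sym (proj₂ (⟶-theta r s 0 2s<r n) (k + suc n) (ℕ.m≤n+m (suc n) k)))
         (Σ-split t k (suc n) .at n)) ⟩
  partialSum t 0 k n ℤ.+ partialSum t k (suc n) n ℤ.- partialSum t 0 k n
    ≡⟨ solve 2 (λ x y → x :+ y :- x := y) refl (partialSum t 0 k n) (partialSum t k (suc n) n) ⟩
  numerator r s k n ∎)
  where
  t = thetaTerm r s
  open +-*-Solver
  open ≡-Reasoning

-- (-1)^(k-1) (1 - q^s)^(-1) times the first k terms of the theta series: since
-- (1 - q^((2j+1)s)) / (1 - q^s) takes the value 2j+1 at q = 1, its own value is
-- (2k-1) - (2k-3) + … = k.
head : ℕ → ℕ → ℕ → Series
head r s zero    = 0ₛ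
head r s (suc k) = q^ (exponent r k ∸ s * k) ⊛ [ suc (k + k) ] s ⊕ ⊝ head r s k

-- The two exponents of the `j`-th term differ by `(2j + 1) s`, and `1 - q^((2j+1)s)` is `1 - q^s`
-- times a q-integer. The alternating signs are absorbed by subtracting the previous head at each
-- step.
partialSum-head : ∀ r s k → 2 * s < r →
                  partialSum (thetaTerm r s) 0 k ≈ ⊝ (sgn k ⊛ (1−q^ s ⊛ head r s k))
partialSum-head r s zero    2s<r = solve 1 (λ x → con 0ℤ := :- (con 1ℤ :* (x :* con 0ℤ))) ≈-refl (1−q^ s)
  where open S
partialSum-head r s (suc k) 2s<r = begin
  partialSum (thetaTerm r s) 0 k ⊕ thetaTerm r s k
    ≈⟨ ⊕-cong (partialSum-head r s k 2s<r) (≈-trans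
         (≈-sym (const-⊛ (-1ℤ ℤ.^ k) (q^ e ⊖ q^ (exponent r k + (k + 1) * s))))
         (⊛-cong (-1^-sgn k) (≈-trans factor (⊛-congˡ (q^ e) (≈-sym ([]-telescope (suc (k + k)) s)))))) ⟩
  ⊝ (σ ⊛ (1−q^ s ⊛ h)) ⊕ σ ⊛ (q^ e ⊛ (1−q^ s ⊛ g))
    ≈⟨ solve 5 (λ σ x h y g → :- (σ :* (x :* h)) :+ σ :* (y :* (x :* g)) := :- ((:- σ) :* (x :* (y :* g :+ :- h))))
         ≈-refl σ (1−q^ s) h (q^ e) g ⟩
  ⊝ (sgn (suc k) ⊛ (1−q^ s ⊛ head r s (suc k))) ∎
  where
  open S
  open ≈-Reasoning
  σ = sgn k
  e = exponent r k ∸ s * k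
  h = head r s k
  g = [ suc (k + k) ] s
  exponents : exponent r k + (k + 1) * s ≡ e + s * suc (k + k)
  exponents = trans (cong (_+ (k + 1) * s) (sym (ℕ.m∸n+n≡m (sj≤exponent r s k 2s<r))))
    (ℕS.solve 3 (λ e s k → e ℕS.:+ s ℕS.:* k ℕS.:+ (k ℕS.:+ ℕS.con 1) ℕS.:* s ℕS.:=
       e ℕS.:+ s ℕS.:* (ℕS.con 1 ℕS.:+ (k ℕS.:+ k))) refl e s k)
    where module ℕS = ℕ-Solver
  factor : q^ e ⊖ q^ (exponent r k + (k + 1) * s) ≈ q^ e ⊛ 1−q^ (s * suc (k + k))
  factor = ≈-trans (⊖-cong (≈-refl {q^ e}) (≈-trans (q^-cong exponents) (≈-sym (q^-+ e (s * suc (k + k))))))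
    (solve 2 (λ x y → x :- x :* y := x :* (con 1ℤ :- y)) ≈-refl (q^ e) (q^ (s * suc (k + k))))

-- Expansion of the truncated series and the final estimate

module Expansion (r s k : ℕ) (1≤s : 1 ≤ s) (r⊥s : Coprime r s) (2s<r : 2 * s < r) where

  s<r : s < r
  s<r = ℕ.≤-<-trans (ℕ.m≤n*m s 2) 2s<r

  1≤r : 1 ≤ r
  1≤r = ℕ.≤-trans (s≤s z≤n) s<r

  a b c : ℕ
  a = r ∸ s
  b = a + r
  c = b + r

  1≤a : 1 ≤ a
  1≤a = ℕ.m<n⇒0<n∸m s<r

  1≤b : 1 ≤ b
  1≤b = ℕ.≤-trans 1≤a (ℕ.m≤m+n a r)

  1≤c : 1 ≤ c
  1≤c = ℕ.≤-trans 1≤b (ℕ.m≤m+n b r)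

  -- A common divisor of `a` and `a + r` divides `r`, hence also `s = r - a`.
  a⊥b : Coprime a b
  a⊥b {d} (d∣a , d∣b) = r⊥s (d∣r , ∣m+n∣m⇒∣n (subst (d ∣_) (sym (ℕ.m∸n+n≡m (ℕ.<⇒≤ s<r))) d∣r) d∣a)
    where
    d∣r : d ∣ r
    d∣r = ∣m+n∣m⇒∣n d∣b d∣a

  open Residue a b c 1≤a 1≤b 1≤c a⊥b
  open ValueAt1

  -- What remains of the denominator without its factors of exponents `s`, `a`, `b` and `c`.
  D′ P : Series
  D′ = qPochhammer (s + r) r ⊛ qPochhammer (c + r) r
  P = inv D′

  1≤s+r : 1 ≤ s + r
  1≤s+r = ℕ.≤-trans 1≤s (ℕ.m≤m+n s r)

  1≤c+r : 1 ≤ c + r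
  1≤c+r = ℕ.≤-trans 1≤c (ℕ.m≤m+n c r)

  P-slow : SlowlyGrowing P
  P-slow = slowlyGrowing (s + r) (c + r) r 1≤s+r 1≤c+r 1≤r

  denominator-split : denominator r s ≈ 1−q^ s ⊛ (1−q^ a ⊛ 1−q^ b ⊛ 1−q^ c ⊛ D′)
  denominator-split = begin
    qPochhammer s r ⊛ qPochhammer a r
      ≈⟨ ⊛-cong {qPochhammer s r} {1−q^ s ⊛ Qs} {qPochhammer a r} {ev ⊛ Qc} (qPochhammer-step s r 1≤s 1≤r) step-a ⟩
    (1−q^ s ⊛ Qs) ⊛ (ev ⊛ Qc)
      ≈⟨ solve 4 (λ x f y g → (x :* f) :* (y :* g) := x :* (y :* (f :* g))) ≈-refl (1−q^ s) Qs ev Qc ⟩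
    1−q^ s ⊛ (ev ⊛ D′) ∎
    where
    open S
    open ≈-Reasoning
    ev Qs Qc : Series
    ev = 1−q^ a ⊛ 1−q^ b ⊛ 1−q^ c
    Qs = qPochhammer (s + r) r
    Qc = qPochhammer (c + r) r
    step-b : qPochhammer b r ≈ 1−q^ b ⊛ (1−q^ c ⊛ Qc)
    step-b = begin
      qPochhammer b r            ≈⟨ qPochhammer-step b r 1≤b 1≤r ⟩
      1−q^ b ⊛ qPochhammer c r
        ≈⟨ ⊛-congˡ (1−q^ b) {qPochhammer c r} {1−q^ c ⊛ Qc} (qPochhammer-step c r 1≤c 1≤r) ⟩
      1−q^ b ⊛ (1−q^ c ⊛ Qc)     ∎
    step-a : qPochhammer a r ≈ ev ⊛ Qc
    step-a = begin
      qPochhammer a r            ≈⟨ qPochhammer-step a r 1≤a 1≤r ⟩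
      1−q^ a ⊛ qPochhammer b r
        ≈⟨ ⊛-congˡ (1−q^ a) {qPochhammer b r} {1−q^ b ⊛ (1−q^ c ⊛ Qc)} step-b ⟩
      1−q^ a ⊛ (1−q^ b ⊛ (1−q^ c ⊛ Qc))
        ≈⟨ solve 4 (λ x y z g → x :* (y :* (z :* g)) := x :* y :* z :* g) ≈-refl (1−q^ a) (1−q^ b) (1−q^ c) Qc ⟩
      ev ⊛ Qc                    ∎

  P-inverse : P ⊛ D′ ≈ 1ₛ
  P-inverse = inv-inverseˡ D′ (⊛-0 (qPochhammer (s + r) r) (qPochhammer (c + r) r)
    (qPochhammer-0 (s + r) r 1≤s+r) (qPochhammer-0 (c + r) r 1≤c+r))

  -- The reciprocal of the denominator in factored form; uniqueness of inverses identifies it with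
  -- `inv`.
  W : Series
  W = geom s ⊛ (v ⊛ P)

  W-inverse : W ⊛ denominator r s ≈ 1ₛ
  W-inverse = begin
    W ⊛ denominator r s
      ≈⟨ ⊛-congˡ W {denominator r s} {1−q^ s ⊛ (ev ⊛ D′)} denominator-split ⟩
    W ⊛ (1−q^ s ⊛ (ev ⊛ D′))
      ≈⟨ inverse-⊛ (geom s) (1−q^ s) (v ⊛ P) (ev ⊛ D′) (geom-inverse s 1≤s)
                                                           (inverse-⊛ v ev P D′ v-inverse P-inverse) ⟩
    1ₛ                                                 ∎
    where
    open ≈-Reasoning
    ev : Series
    ev = 1−q^ a ⊛ 1−q^ b ⊛ 1−q^ c
    v-inverse : v ⊛ ev ≈ 1ₛ
    v-inverse = inverse-⊛ (geom a ⊛ geom b) (1−q^ a ⊛ 1−q^ b) (geom c) (1−q^ c)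
      (inverse-⊛ (geom a) (1−q^ a) (geom b) (1−q^ b) (geom-inverse a 1≤a) (geom-inverse b 1≤b)) (geom-inverse c 1≤c)

  H E : Series
  H = head r s k
  E = qPochhammer r r

  numerator-⊘ : numerator r s k ⊘ denominator r s ≈ E ⊕ sgn k ⊛ (H ⊛ v ⊛ P)
  numerator-⊘ = begin
    numerator r s k ⊘ d
      ≈⟨ ⊘≈⊛inv (numerator r s k) d d₀ ⟩
    numerator r s k ⊛ inv d
      ≈⟨ ⊛-cong {numerator r s k} {d ⊛ E ⊖ ⊝ Y} {inv d} {W} numerator≈ (≈-sym (inv-unique d W d₀ W-inverse)) ⟩
    (d ⊛ E ⊖ ⊝ Y) ⊛ W
      ≈⟨ solve 4 (λ d e y w → (d :* e :- (:- y)) :* w := (w :* d) :* e :+ y :* w) ≈-refl d E Y W ⟩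
    (W ⊛ d) ⊛ E ⊕ Y ⊛ W
      ≈⟨ ⊕-cong {(W ⊛ d) ⊛ E} {1ₛ ⊛ E} {Y ⊛ W} {1ₛ ⊛ X} (⊛-congʳ E {W ⊛ d} {1ₛ} W-inverse) Y⊛W ⟩
    1ₛ ⊛ E ⊕ 1ₛ ⊛ X
      ≈⟨ ⊕-cong {1ₛ ⊛ E} {E} {1ₛ ⊛ X} {X} (⊛-identityˡ E) (⊛-identityˡ X) ⟩
    E ⊕ X ∎
    where
    open S
    open ≈-Reasoning
    d σ X Y : Series
    d = denominator r s
    σ = sgn k
    X = σ ⊛ (H ⊛ v ⊛ P)
    Y = σ ⊛ (1−q^ s ⊛ H)
    d₀ = denominator-0 r s 1≤s 2s<r
    Y⊛W : Y ⊛ W ≈ 1ₛ ⊛ X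
    Y⊛W = begin
      (σ ⊛ (1−q^ s ⊛ H)) ⊛ (geom s ⊛ (v ⊛ P))
        ≈⟨ solve 5 (λ σ x h g u → (σ :* (x :* h)) :* (g :* u) := (g :* x) :* (σ :* (h :* u))) ≈-refl σ (1−q^ s) H (geom s) (v ⊛ P) ⟩
      (geom s ⊛ 1−q^ s) ⊛ (σ ⊛ (H ⊛ (v ⊛ P)))
        ≈⟨ ⊛-cong {geom s ⊛ 1−q^ s} {1ₛ} {σ ⊛ (H ⊛ (v ⊛ P))} {X} (geom-inverse s 1≤s)
             (⊛-congˡ σ {H ⊛ (v ⊛ P)} {H ⊛ v ⊛ P} (≈-sym (⊛-assoc H v P))) ⟩
      1ₛ ⊛ X ∎
    numerator≈ : numerator r s k ≈ d ⊛ E ⊖ ⊝ Y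
    numerator≈ = ≈-trans (numerator-tail r s k 2s<r)
      (⊖-cong {sumFrom 0 (thetaTerm r s)} {d ⊛ E} {partialSum (thetaTerm r s) 0 k} {⊝ Y}
        (jacobi-triple-product r s 1≤s 2s<r) (partialSum-head r s k 2s<r))

  -- The prefactor `(-1)^k` meets the same sign in front of the head and cancels it; only `E` keeps
  -- a sign.
  truncatedSeries-expansion : truncatedSeries r s k ≈ sgn k ⊛ E ⊕ H ⊛ v ⊛ P
  truncatedSeries-expansion = begin
    (-1ℤ ℤ.^ k) · quotient          ≈⟨ const-⊛ (-1ℤ ℤ.^ k) quotient ⟨
    const (-1ℤ ℤ.^ k) ⊛ quotient
      ≈⟨ ⊛-cong {const (-1ℤ ℤ.^ k)} {σ} {quotient} {E ⊕ σ ⊛ X} (-1^-sgn k) numerator-⊘ ⟩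
    σ ⊛ (E ⊕ σ ⊛ X)
      ≈⟨ solve 3 (λ σ e x → σ :* (e :+ σ :* x) := σ :* e :+ (σ :* σ) :* x) ≈-refl σ E X ⟩
    σ ⊛ E ⊕ (σ ⊛ σ) ⊛ X
      ≈⟨ ⊕-cong {σ ⊛ E} {σ ⊛ E} {(σ ⊛ σ) ⊛ X} {1ₛ ⊛ X} (≈-refl {σ ⊛ E}) (⊛-congʳ X {σ ⊛ σ} {1ₛ} (sgn² k)) ⟩
    σ ⊛ E ⊕ 1ₛ ⊛ X
      ≈⟨ ⊕-cong {σ ⊛ E} {σ ⊛ E} {1ₛ ⊛ X} {X} (≈-refl {σ ⊛ E}) (⊛-identityˡ X) ⟩
    σ ⊛ E ⊕ X                       ∎
    where
    open S
    open ≈-Reasoning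
    quotient σ X : Series
    quotient = numerator r s k ⊘ denominator r s
    σ = sgn k
    X = H ⊛ v ⊛ P

  head-value : ∀ j → ValueAt1 (head r s j) (ℤ.+ j)
  head-value zero    = at1-0
  head-value (suc j) = subst (ValueAt1 (head r s (suc j))) (value≡ (ℤ.+ j))
    (at1-⊕ (at1-⊛ (at1-q^ (exponent r j ∸ s * j)) (at1-[] (suc (j + j)) s)) (at1-⊝ (head-value j)))
    where
    open +-*-Solver
    value≡ : ∀ j → 1ℤ ℤ.* (1ℤ ℤ.+ (j ℤ.+ j)) ℤ.+ ℤ.- j ≡ 1ℤ ℤ.+ j
    value≡ = solve 1 (λ j → con 1ℤ :* (con 1ℤ :+ (j :+ j)) :+ :- j := con 1ℤ :+ j) refl

  open SlowlyGrowing P-slow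

  -- The error from `E` is not convolved with `P`; since `1ₛ ≼ P`, it can still be charged to
  -- `linear ⊛ P`.
  linear≼linear⊛P : linear ≼ linear ⊛ P
  linear≼linear⊛P = ≼-trans (≈⇒≽ (⊛-identityˡ linear)) (≼-trans (⊛-monoˡ-≼ linear (pointwise≤ λ n → 0≤+ (suc n)) 1≼P)
    (≈⇒≼ (⊛-comm P linear)))
    where
    1≼P : 1ₛ ≼ P
    1≼P .at≤ zero    = ℤ.≤-reflexive (sym p₀)
    1≼P .at≤ (suc n) = nonneg .at≤ (suc n)

  0<abc : 0ℤ ℤ.< ℤ.+ 2 ℤ.* abc
  0<abc = subst (0ℤ ℤ.<_) (trans (ℤ.pos-* 2 (a * b * c)) (cong (ℤ.+ 2 ℤ.*_)
      (trans (ℤ.pos-* (a * b) c) (cong (ℤ._* ℤ.+ c) (ℤ.pos-* a b)))))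
    (ℤ.+<+ (ℕ.*-mono-≤ {1} {2} (s≤s z≤n) (ℕ.*-mono-≤ (ℕ.*-mono-≤ 1≤a 1≤b) 1≤c)))

  -∣i∣≤i : ∀ i {B} → ∣ i ∣ ≤ B → ℤ.- (ℤ.+ B) ℤ.≤ i
  -∣i∣≤i i {B} p = ℤ.≤-trans (ℤ.≤-reflexive (sym (ℤ.+-identityˡ (ℤ.- (ℤ.+ B)))))
    (∣i-j∣≤⇒j-B≤i {i} {0ℤ} B (subst (λ x → ∣ x ∣ ≤ B) (sym (ℤ.+-identityʳ i)) p))

  -- After scaling by `2 abc > 0`, the head contributes at least `Z - C L` and `E` at least
  -- `- C′ L`, so it remains to have `(C + C′) L ≤ Z`, which holds from the threshold in `key` on.
  eventually-nonneg : 1 ≤ k → ∃[ N ] (∀ n → N ≤ n → 0ℤ ℤ.≤ truncatedSeries r s k n)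
  eventually-nonneg 1≤k = proj₁ key , λ n N≤n → ℤ.*-cancelˡ-≤-pos 0ℤ (truncatedSeries r s k n) (ℤ.+ 2 ℤ.* abc) {{ℤ.positive 0<abc}} (begin
    ℤ.+ 2 ℤ.* abc ℤ.* 0ℤ                                 ≡⟨ ℤ.*-zeroʳ (ℤ.+ 2 ℤ.* abc) ⟩
    0ℤ                                                   ≤⟨ ℤ.i≤j⇒0≤j-i (proj₂ key n N≤n) ⟩
    Z n ℤ.- ℤ.+ (C + C′) ℤ.* L n
      ≡⟨ solve 4 (λ z c d l → z :- (c :+ d) :* l := :- (d :* l) :+ (z :- c :* l)) refl (Z n) (ℤ.+ C) (ℤ.+ C′) (L n) ⟩
    ℤ.- (ℤ.+ C′ ℤ.* L n) ℤ.+ (Z n ℤ.- ℤ.+ C ℤ.* L n)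
      ≤⟨ ℤ.+-mono-≤ (ℤ.≤-trans (ℤ.neg-mono-≤ (*-monoˡ (0≤+ C′) (linear≼linear⊛P .at≤ n))) (E-part n)) (H-part n) ⟩
    ℤ.+ 2 ℤ.* abc ℤ.* (sgn k ⊛ E) n ℤ.+ ℤ.+ 2 ℤ.* abc ℤ.* (H ⊛ v ⊛ P) n
                                                         ≡⟨ ℤ.*-distribˡ-+ (ℤ.+ 2 ℤ.* abc) ((sgn k ⊛ E) n) ((H ⊛ v ⊛ P) n) ⟨
    ℤ.+ 2 ℤ.* abc ℤ.* (sgn k ⊛ E ⊕ H ⊛ v ⊛ P) n
      ≡⟨ cong (ℤ._*_ (ℤ.+ 2 ℤ.* abc)) (truncatedSeries-expansion .at n) ⟨
    ℤ.+ 2 ℤ.* abc ℤ.* truncatedSeries r s k n            ∎)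
    where
    open +-*-Solver
    open ℤ.≤-Reasoning
    open LowerBound k 1≤k (head-value k) using (C; lower-bound)
    E-linear : Linear (const (ℤ.+ 2 ℤ.* abc) ⊛ (sgn k ⊛ E))
    E-linear = O-const (ℤ.+ 2 ℤ.* abc) (sgn-linear k (qPochhammer-linear r 1≤r))
    open _∈O_ E-linear renaming (constant to C′; bound to E-bound)
    Z L : Series
    Z = sq ⊛ P
    L = linear ⊛ P
    key = linear-⊛-≤-sq-⊛ P-slow (C + C′)
    E-part : ∀ n → ℤ.- (ℤ.+ C′ ℤ.* linear n) ℤ.≤ ℤ.+ 2 ℤ.* abc ℤ.* (sgn k ⊛ E) n
    E-part n = begin
      ℤ.- (ℤ.+ C′ ℤ.* linear n)                    ≡⟨ cong ℤ.-_ (ℤ.pos-* C′ (suc n)) ⟨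
      ℤ.- (ℤ.+ (C′ * suc n))
        ≤⟨ -∣i∣≤i ((const (ℤ.+ 2 ℤ.* abc) ⊛ (sgn k ⊛ E)) n) (E-bound n) ⟩
      (const (ℤ.+ 2 ℤ.* abc) ⊛ (sgn k ⊛ E)) n      ≡⟨ const-⊛ (ℤ.+ 2 ℤ.* abc) (sgn k ⊛ E) .at n ⟩
      ℤ.+ 2 ℤ.* abc ℤ.* (sgn k ⊛ E) n              ∎
    H-part : ∀ n → Z n ℤ.- ℤ.+ C ℤ.* L n ℤ.≤ ℤ.+ 2 ℤ.* abc ℤ.* (H ⊛ v ⊛ P) n
    H-part n = begin
      Z n ℤ.- ℤ.+ C ℤ.* L n
        ≡⟨ cong (ℤ._-_ (Z n)) (·-⊛ (ℤ.+ C) linear P .at n) ⟨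
      (sq ⊛ P ⊖ (ℤ.+ C · linear) ⊛ P) n
        ≡⟨ S.solve 3 (λ x y p → x S.:* p S.:- y S.:* p S.:= (x S.:- y) S.:* p) ≈-refl sq (ℤ.+ C · linear) P .at n ⟩
      ((sq ⊖ ℤ.+ C · linear) ⊛ P) n
        ≤⟨ ⊛-monoˡ-≼ P nonneg (pointwise≤ λ m → ℤ.≤-trans (lower-bound m)
                                                        (ℤ.≤-reflexive (sym (ℤ.*-assoc (ℤ.+ 2) abc ((H ⊛ v) m))))) .at≤ n ⟩
      ((ℤ.+ 2 ℤ.* abc · (H ⊛ v)) ⊛ P) n            ≡⟨ ·-⊛ (ℤ.+ 2 ℤ.* abc) (H ⊛ v) P .at n ⟩
      ℤ.+ 2 ℤ.* abc ℤ.* (H ⊛ v ⊛ P) n              ∎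

theorem1p4 : (r s k : ℕ) → 1 ≤ r → 1 ≤ s → Coprime r s → 2 * s < r → 1 ≤ k →
    ∃[ N ] ((n : ℕ) → N ≤ n → 0ℤ ℤ.≤ truncatedSeries r s k n)
theorem1p4 r s k _ 1≤s r⊥s 2s<r 1≤k = Expansion.eventually-nonneg r s k 1≤s r⊥s 2s<r 1≤k
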